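{- Mult-primality of a tree $T$ can be decided in time polynomial in $n_T$. That is, there is an algorithm which, given a tree $T$ with $n_T>1$, decides whether $T$ is mult-prime in time bounded by a polynomial in $n_T$.
   Context: A "tree" is a finite non-empty rooted unordered tree; two trees are regarded as equal if they are isomorphic as rooted trees. $\mathbf{1}$ is the tree with exactly one vertex, $n_T$ is the number of vertices of $T$, and $r(T)$ is its root. The subtrees of $r(T)$ are the trees rooted at the children of $r(T)$, each consisting of a child and all its descendants. Multiplication: $A\cdot B$ is the tree obtained by merging the root of a (separate) copy of $B$ with each vertex $x\in A$, so that all the subtrees of $r(B)$ become new subtrees of $x$ (in addition to those $x$ already has in $A$). A tree $T$ with $n_T>1$ is mult-prime if it can be generated by multiplication only if the factors are $\mathbf{1}$ and $T$, i.e. $T=A\cdot B$ implies that one of $A,B$ is $\mathbf{1}$ and the other is $T$. Input trees are given by any standard explicit encoding of size polynomial in $n_T$, e.g. the binary sequence of length $2n_T$ obtained by a preorder traversal writing $1$ for each vertex encountered and $0$ for each move backwards. -}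

module Defs where

open import Data.Bool.Base using (Bool; true; false)
open import Data.Fin.Base using (Fin)
open import Data.List.Base using (List; []; _∷_; [_]; _++_; map; foldr)
open import Data.List.Relation.Binary.Permutation.Homogeneous using (Permutation)
open import Data.Maybe.Base using (Maybe; just; nothing)
open import Data.Nat.Base using (ℕ; zero; suc; _+_; _*_; _<_)
open import Data.Product.Base using (_×_; _,_; ∃-syntax)
open import Data.Sum.Base using (_⊎_; inj₁; inj₂)
open import Data.Vec.Base as Vec using (Vec; _∷_)
open import Relation.Binary.PropositionalEquality.Core using (_≡_)
open import Relation.Nullary.Reflects using (Reflects)

infix  4 _≅_
infixl 7 _·_ _·*_

-- An unordered tree is represented by listing the subtrees of each vertex in
-- some order; the orderings are forgotten by _≅_.

data Tree : Set where
  node : List Tree → Tree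

subtrees : Tree → List Tree
subtrees (node ts) = ts

-- Isomorphism of rooted trees: the subtrees of the two roots can be matched
-- bijectively so that matched subtrees are isomorphic.

data _≅_ : Tree → Tree → Set where
  match : ∀ {ts us} → Permutation _≅_ ts us → node ts ≅ node us

𝟏 : Tree
𝟏 = node []

mutual
  size : Tree → ℕ
  size (node ts) = suc (size* ts)

  size* : List Tree → ℕ
  size* []       = 0
  size* (t ∷ ts) = size t + size* ts

-- Every vertex of A, the root included, keeps its own subtrees and
-- additionally receives the subtrees of the root of B.

mutual
  _·_ : Tree → Tree → Tree
  node as · B = node (as ·* B ++ subtrees B)

  _·*_ : List Tree → Tree → List Tree
  []       ·* B = []
  (A ∷ as) ·* B = (A · B) ∷ (as ·* B)

MultPrime : Tree → Set
MultPrime T = 1 < size T ×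
  (∀ A B → T ≅ A · B → (A ≅ 𝟏 × B ≅ T) ⊎ (A ≅ T × B ≅ 𝟏))

-- Preorder traversal: true on entering a vertex, false on leaving it (also
-- for the root), hence 2 * size T bits. Isomorphic trees may have different
-- encodings.

mutual
  encode : Tree → List Bool
  encode (node ts) = true ∷ encode* ts ++ [ false ]

  encode* : List Tree → List Bool
  encode* []       = []
  encode* (t ∷ ts) = encode t ++ encode* ts

-- Deterministic multi-tape Turing machines.

data Symbol (aux : ℕ) : Set where
  blank : Symbol aux
  bit   : Bool → Symbol aux
  extra : Fin aux → Symbol aux

data Move : Set where
  left stay right : Move

-- A tape is infinite in both directions. The two lists run outwards from the
-- head; every cell beyond their ends is blank.

record Tape (aux : ℕ) : Set where
  constructor tape
  field
    before : List (Symbol aux)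
    head   : Symbol aux
    after  : List (Symbol aux)

fromCells : ∀ {aux} → List (Symbol aux) → Tape aux
fromCells []       = tape [] blank []
fromCells (x ∷ xs) = tape [] x xs

writeMove : ∀ {aux} → Symbol aux × Move → Tape aux → Tape aux
writeMove (y , stay)  (tape ls       _ rs)       = tape ls y rs
writeMove (y , left)  (tape []       _ rs)       = tape [] blank (y ∷ rs)
writeMove (y , left)  (tape (l ∷ ls) _ rs)       = tape ls l (y ∷ rs)
writeMove (y , right) (tape ls       _ [])       = tape (y ∷ ls) blank []
writeMove (y , right) (tape ls       _ (r ∷ rs)) = tape (y ∷ ls) r rs

-- From the current state and the scanned symbols, δ either halts with a
-- verdict (true for acceptance) or gives the next state and, for every tape,
-- a symbol to write and a move. Tape 0 initially carries the input.

record TuringMachine : Set where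
  field
    states aux workTapes : ℕ
    start : Fin states
    δ     : Fin states → Vec (Symbol aux) (suc workTapes) →
            Bool ⊎ (Fin states × Vec (Symbol aux × Move) (suc workTapes))

module _ (M : TuringMachine) where
  open TuringMachine M

  Config : Set
  Config = Fin states × Vec (Tape aux) (suc workTapes)

  initial : List Bool → Config
  initial w = start , fromCells (map bit w) ∷ Vec.replicate workTapes (fromCells [])

  step : Config → Bool ⊎ Config
  step (q , ts) with δ q (Vec.map Tape.head ts)
  ... | inj₁ b        = inj₁ b
  ... | inj₂ (q′ , a) = inj₂ (q′ , Vec.zipWith writeMove a ts)

  -- The verdict, provided it is reached within the given number of steps.

  run : ℕ → Config → Maybe Bool
  run zero    c = nothing
  run (suc t) c with step c
  ... | inj₁ b  = just b
  ... | inj₂ c′ = run t c′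

  DecidesWithin : ℕ → List Bool → Set → Set
  DecidesWithin t w P = ∃[ b ] run t (initial w) ≡ just b × Reflects P b

-- Polynomials with coefficients in ℕ, constant term first.

Polynomial : Set
Polynomial = List ℕ

eval : Polynomial → ℕ → ℕ
eval p n = foldr (λ c r → c + n * r) 0 p

{-# OPTIONS --safe #-}
module Submission where

-- In a product A · B the subtree at a leaf of A is B itself, so T is composite
-- iff T ≅ A · B for some A and some B ≢ 𝟏 rooted at a vertex of T other than the
-- root. For a given B, the equation T ≅ A · B can be decided greedily: the
-- subtrees of the root of T that have isomorphic partners among the subtrees of
-- the root of B are matched with these, all subtrees of the root of B have to be
-- used, and the unmatched subtrees of T have to be divisible by B in turn;
-- cancellation of multisets shows that the choice of partners does not matter.
-- Isomorphism is decided by comparing canonical forms, which are obtained by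
-- sorting the subtrees of every vertex.
--
-- The time bound rests on a class of functions on trees that are computed in
-- polynomial time by Turing machines with four tapes used as stacks. The class
-- is closed under composition, list operations, case distinction, comparison and
-- iteration over the bits of an encoding with polynomially bounded intermediate
-- results, and therefore under paramorphisms on trees, from which all parts of
-- the algorithm are built.

open import Defs
open import Data.Bool.Base using (Bool; true; false; not; if_then_else_; _∧_; _∨_)
open import Data.Fin.Base using (Fin; zero; suc; _↑ˡ_; _↑ʳ_; splitAt)
open import Data.Fin.Patterns
open import Data.Fin.Properties using (splitAt-↑ˡ; splitAt-↑ʳ)
open import Data.List.Base as List using (List; []; _∷_; [_]; _++_; _ʳ++_; replicate; length; foldr; null)
open import Data.List.Properties using (++-identityʳ; ++-assoc; ++-ʳ++; ʳ++-ʳ++; length-++; length-ʳ++; ∷-injective)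
import Data.List.Relation.Binary.Permutation.Homogeneous as Homogeneous
open import Data.List.Relation.Binary.Pointwise.Base using (Pointwise; []; _∷_)
open import Data.List.Relation.Unary.All as All using (All; []; _∷_)
open import Data.List.Relation.Unary.All.Properties using (++⁻ʳ)
open import Data.List.Relation.Unary.Any using (Any; here; there)
open import Data.Maybe.Base using (Maybe; just; nothing)
open import Data.Nat.Base
open import Data.Nat.Properties
open import Data.Nat.Tactic.RingSolver using (solve-∀)
open import Data.Product.Base using (_×_; _,_; ∃-syntax; proj₁; proj₂)
open import Data.Sum.Base using (_⊎_; inj₁; inj₂)
open import Data.Vec.Base as Vec using (Vec; []; _∷_; lookup; updateAt; zipWith)
open import Data.Vec.Relation.Binary.Pointwise.Inductive as VecPointwise using ([]; _∷_)
open import Function.Base using (id)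
open import Level using (0ℓ)
open import Relation.Binary.Bundles using (Setoid)
open import Relation.Binary.PropositionalEquality hiding ([_])
open import Relation.Nullary.Negation using (¬_; contradiction)
open import Relation.Nullary.Reflects using (Reflects; ofʸ; ofⁿ)

-- Stacks on the tapes of a Turing machine

Sym : Set
Sym = Symbol 0

Stack : Set
Stack = List Sym

top : Stack → Sym
top []      = blank
top (s ∷ _) = s

pop′ : Stack → Stack
pop′ []       = []
pop′ (_ ∷ st) = st

-- The stack is the part of the tape from the head rightwards; the cells to the
-- left of the head are irrelevant.

data Holds (st : Stack) : Tape 0 → Set where
  holds : ∀ {ls h rs} k → h ∷ rs ≡ st ++ replicate k blank → Holds st (tape ls h rs)

holds-top : ∀ {st t} → Holds st t → Tape.head t ≡ top st
holds-top {[]}    (holds (suc k) refl) = refl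
holds-top {s ∷ _} (holds k refl)       = refl

-- Popping is a move to the right, and whatever is written ends up among the irrelevant cells. Where
-- the tape ends at the head, the move supplies a fresh blank, which is why `k` becomes 1 there.
holds-pop : ∀ {st t} y → Holds st t → Holds (pop′ st) (writeMove (y , right) t)
holds-pop {[]}         y (holds {rs = []} (suc zero) refl) = holds 1 refl
holds-pop {[]}         y (holds {rs = _ ∷ _} (suc k) eq)   = holds k (cong pop′ eq)
holds-pop {_ ∷ []}     y (holds {rs = []} zero refl)       = holds 1 refl
holds-pop {_ ∷ st}     y (holds {rs = _ ∷ _} k eq)         = holds k (cong pop′ eq)

-- The cell to the left may contain debris of earlier pops. A push therefore takes two steps: a move
-- onto this unknown symbol `x`, then `holds-write`.
holds-left : ∀ {st t} → Holds st t → ∃[ x ] Holds (x ∷ st) (writeMove (Tape.head t , left) t)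
holds-left (holds {[]}    k eq) = blank , holds k (cong (blank ∷_) eq)
holds-left (holds {l ∷ _} k eq) = l , holds k (cong (l ∷_) eq)

holds-write : ∀ {x st t} y → Holds (x ∷ st) t → Holds (y ∷ st) (writeMove (y , stay) t)
holds-write y (holds k eq) = holds k (cong (λ cs → y ∷ pop′ cs) eq)

Action : Set
Action = Sym × Move

idle : Sym → Action
idle s = s , stay

onTape : ∀ {n} → Fin n → (Sym → Action) → Vec Sym n → Vec Action n
onTape i f hs = updateAt (Vec.map idle hs) i (λ a → f (proj₁ a))

act : ∀ {n} → Vec Action n → Vec (Tape 0) n → Vec (Tape 0) n
act = zipWith writeMove

infix 4 _⊩_

_⊩_ : ∀ {n} → Vec Stack n → Vec (Tape 0) n → Set
_⊩_ = VecPointwise.Pointwise Holds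

heads : ∀ {n} → Vec (Tape 0) n → Vec Sym n
heads = Vec.map Tape.head

tops : ∀ {n} → Vec Stack n → Vec Sym n
tops = Vec.map top

heads≡tops : ∀ {n} {σ : Vec Stack n} {ts} → σ ⊩ ts → heads ts ≡ tops σ
heads≡tops []       = refl
heads≡tops (h ∷ hs) = cong₂ _∷_ (holds-top h) (heads≡tops hs)

act-idle : ∀ {n} (ts : Vec (Tape 0) n) → act (Vec.map idle (heads ts)) ts ≡ ts
act-idle []       = refl
act-idle (t ∷ ts) = cong (t ∷_) (act-idle ts)

holds-onTape : ∀ {n} {σ : Vec Stack n} {ts} i f {g : Stack → Stack} →
  (∀ {t} → Holds (lookup σ i) t → Holds (g (lookup σ i)) (writeMove (f (Tape.head t)) t)) →
  σ ⊩ ts → updateAt σ i g ⊩ act (onTape i f (heads ts)) ts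
holds-onTape {ts = _ ∷ ts} zero f step (h ∷ hs) =
  step h ∷ subst (_ ⊩_) (sym (act-idle ts)) hs
holds-onTape (suc i) f step (h ∷ hs) = h ∷ holds-onTape i f step hs

-- Structured programs on four stacks. Stack 0 holds encoded trees, stacks 1 and 2
-- buffer reversed encodings, and stack 3 is a unary counter.

data Cmd : Set where
  skip   : Cmd
  push   : Fin 4 → Sym → Cmd
  pop    : Fin 4 → Cmd
  _⨟_    : Cmd → Cmd → Cmd
  branch : (Vec Sym 4 → Bool) → Cmd → Cmd → Cmd
  while  : (Vec Sym 4 → Bool) → Cmd → Cmd

infixr 5 _⨟_

Store : Set
Store = Vec Stack 4

infix 4 _⊢_⇓[_]_

-- The costs are the exact step counts of the compiled machines: a push takes two steps, and each
-- test takes one. Sequencing is free, because the last transition of `c` leads directly to the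
-- entry of `d`.
data _⊢_⇓[_]_ : Cmd → Store → ℕ → Store → Set where
  skip   : ∀ {σ} → skip ⊢ σ ⇓[ 1 ] σ
  push   : ∀ {i s σ} → push i s ⊢ σ ⇓[ 2 ] updateAt σ i (s ∷_)
  pop    : ∀ {i σ} → pop i ⊢ σ ⇓[ 1 ] updateAt σ i pop′
  seq    : ∀ {c d σ σ₁ σ₂ m n} → c ⊢ σ ⇓[ m ] σ₁ → d ⊢ σ₁ ⇓[ n ] σ₂ → c ⨟ d ⊢ σ ⇓[ m + n ] σ₂
  if-yes : ∀ {p c d σ σ₁ n} → p (tops σ) ≡ true → c ⊢ σ ⇓[ n ] σ₁ →
           branch p c d ⊢ σ ⇓[ suc n ] σ₁
  if-no  : ∀ {p c d σ σ₁ n} → p (tops σ) ≡ false → d ⊢ σ ⇓[ n ] σ₁ →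
           branch p c d ⊢ σ ⇓[ suc n ] σ₁
  loop   : ∀ {p c σ σ₁ σ₂ m n} → p (tops σ) ≡ true → c ⊢ σ ⇓[ m ] σ₁ →
           while p c ⊢ σ₁ ⇓[ n ] σ₂ → while p c ⊢ σ ⇓[ suc (m + n) ] σ₂
  exit   : ∀ {p c σ} → p (tops σ) ≡ false → while p c ⊢ σ ⇓[ 1 ] σ

-- Compilation to machines with a distinguished exit, represented by nothing

count : Cmd → ℕ
count skip           = 1
count (push i s)     = 2
count (pop i)        = 1
count (c ⨟ d)        = count c + count d
count (branch p c d) = suc (count c + count d)
count (while p c)    = suc (count c)

entry : (c : Cmd) → Fin (count c)
entry skip           = zero
entry (push i s)     = zero
entry (pop i)        = zero
entry (c ⨟ d)        = entry c ↑ˡ count d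
entry (branch p c d) = zero
entry (while p c)    = zero

Target : ℕ → Set
Target n = Maybe (Fin n) × Vec Action 4

redirect : ∀ {m n} → (Fin m → Fin n) → Maybe (Fin n) → Target m → Target n
redirect f e (just q  , as) = just (f q) , as
redirect f e (nothing , as) = e , as

next : (c : Cmd) → Fin (count c) → Vec Sym 4 → Target (count c)
next skip           _          hs = nothing , Vec.map idle hs
next (push i s)     zero       hs = just (suc zero) , onTape i (_, left) hs
next (push i s)     (suc zero) hs = nothing , onTape i (λ _ → s , stay) hs
next (pop i)        _          hs = nothing , onTape i (_, right) hs
next (c ⨟ d)        q          hs with splitAt (count c) q
... | inj₁ q₁ = redirect (_↑ˡ count d) (just (count c ↑ʳ entry d)) (next c q₁ hs)
... | inj₂ q₂ = redirect (count c ↑ʳ_) nothing (next d q₂ hs)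
next (branch p c d) zero       hs =
  just (suc (if p hs then entry c ↑ˡ count d else count c ↑ʳ entry d)) , Vec.map idle hs
next (branch p c d) (suc q)    hs with splitAt (count c) q
... | inj₁ q₁ = redirect (λ r → suc (r ↑ˡ count d)) nothing (next c q₁ hs)
... | inj₂ q₂ = redirect (λ r → suc (count c ↑ʳ r)) nothing (next d q₂ hs)
next (while p c)    zero       hs =
  (if p hs then just (suc (entry c)) else nothing) , Vec.map idle hs
next (while p c)    (suc q)    hs = redirect suc (just zero) (next c q hs)

Tapes : Set
Tapes = Vec (Tape 0) 4

data Run {n} (δ : Fin n → Vec Sym 4 → Target n) : Fin n → Tapes → ℕ → Tapes → Set where
  last : ∀ {q ts as} → δ q (heads ts) ≡ (nothing , as) → Run δ q ts 1 (act as ts)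
  more : ∀ {q q′ ts as k ts′} → δ q (heads ts) ≡ (just q′ , as) →
         Run δ q′ (act as ts) k ts′ → Run δ q ts (suc k) ts′

-- If every step of δ is a step of δ′, up to the renaming of states, then a run
-- of δ is a run of δ′, possibly continued at the state where the exit of δ leads.

module _ {m n} {δ : Fin m → Vec Sym 4 → Target m} {δ′ : Fin n → Vec Sym 4 → Target n}
         {f : Fin m → Fin n} where

  run-exit : (∀ q hs → δ′ (f q) hs ≡ redirect f nothing (δ q hs)) →
             ∀ {q ts k ts′} → Run δ q ts k ts′ → Run δ′ (f q) ts k ts′
  run-exit emb (last eq)   = last (trans (emb _ _) (cong (redirect f nothing) eq))
  run-exit emb (more eq r) = more (trans (emb _ _) (cong (redirect f nothing) eq)) (run-exit emb r)

  run-into : ∀ {e} → (∀ q hs → δ′ (f q) hs ≡ redirect f (just e) (δ q hs)) →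
             ∀ {q ts k ts′ l ts″} → Run δ q ts k ts′ → Run δ′ e ts′ l ts″ → Run δ′ (f q) ts (k + l) ts″
  run-into emb (last eq)   s = more (trans (emb _ _) (cong (redirect f _) eq)) s
  run-into emb (more eq r) s = more (trans (emb _ _) (cong (redirect f _) eq)) (run-into emb r s)

seq-left : ∀ c d q hs → next (c ⨟ d) (q ↑ˡ count d) hs ≡
           redirect (_↑ˡ count d) (just (count c ↑ʳ entry d)) (next c q hs)
seq-left c d q hs rewrite splitAt-↑ˡ (count c) q (count d) = refl

seq-right : ∀ c d q hs → next (c ⨟ d) (count c ↑ʳ q) hs ≡
            redirect (count c ↑ʳ_) nothing (next d q hs)
seq-right c d q hs rewrite splitAt-↑ʳ (count c) (count d) q = refl

if-left : ∀ p c d q hs → next (branch p c d) (suc (q ↑ˡ count d)) hs ≡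
          redirect (λ r → suc (r ↑ˡ count d)) nothing (next c q hs)
if-left p c d q hs rewrite splitAt-↑ˡ (count c) q (count d) = refl

if-right : ∀ p c d q hs → next (branch p c d) (suc (count c ↑ʳ q)) hs ≡
           redirect (λ r → suc (count c ↑ʳ r)) nothing (next d q hs)
if-right p c d q hs rewrite splitAt-↑ʳ (count c) (count d) q = refl

-- Induction on the execution. The machine tests head symbols where the semantics tests stack tops,
-- and `heads≡tops` identifies the two. A test writes back the scanned symbols, so `act-idle`
-- restores the tapes after it.
simulate : ∀ {c σ n σ′ ts} → c ⊢ σ ⇓[ n ] σ′ → σ ⊩ ts →
           ∃[ ts′ ] Run (next c) (entry c) ts n ts′ × σ′ ⊩ ts′
simulate {ts = ts} skip h = _ , last refl , subst (_ ⊩_) (sym (act-idle ts)) h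
simulate (push {i} {s}) h = _ , more refl (last refl) , pushed i _ _ h
  where
  pushed : ∀ {n} (i : Fin n) σ ts → σ ⊩ ts →
    let ts₁ = act (onTape i (_, left) (heads ts)) ts in
    updateAt σ i (s ∷_) ⊩ act (onTape i (λ _ → s , stay) (heads ts₁)) ts₁
  pushed zero    (st ∷ σ) (t ∷ ts) (h ∷ hs) =
    holds-write s (proj₂ (holds-left h)) ∷
    subst (σ ⊩_) (sym (trans (act-idle _) (act-idle ts))) hs
  pushed (suc i) (st ∷ σ) (t ∷ ts) (h ∷ hs) = h ∷ pushed i σ ts hs
simulate (pop {i}) h = _ , last refl , holds-onTape i (_, right) (holds-pop _) h
simulate (seq {c} {d} r s) h with simulate r h
... | _ , r′ , h₁ with simulate s h₁
... | _ , s′ , h₂ = _ , run-into (seq-left c d) r′ (run-exit (seq-right c d) s′) , h₂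
simulate {ts = ts} (if-yes {p} {c} {d} eq r) h with simulate r h
... | _ , r′ , h′ =
  _ , more (cong (λ b → just (suc (if b then entry c ↑ˡ count d else count c ↑ʳ entry d)) , Vec.map idle (heads ts))
                 (trans (cong p (heads≡tops h)) eq))
      (subst (λ ts → Run _ _ ts _ _) (sym (act-idle ts)) (run-exit (if-left p c d) r′)) , h′
simulate {ts = ts} (if-no {p} {c} {d} eq r) h with simulate r h
... | _ , r′ , h′ =
  _ , more (cong (λ b → just (suc (if b then entry c ↑ˡ count d else count c ↑ʳ entry d)) , Vec.map idle (heads ts))
                 (trans (cong p (heads≡tops h)) eq))
      (subst (λ ts → Run _ _ ts _ _) (sym (act-idle ts)) (run-exit (if-right p c d) r′)) , h′
simulate {ts = ts} (loop {p} {c} eq r s) h with simulate r h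
... | _ , r′ , h₁ with simulate s h₁
... | _ , s′ , h₂ =
  _ , more (cong (λ b → (if b then just (suc (entry c)) else nothing) , Vec.map idle (heads ts))
                 (trans (cong p (heads≡tops h)) eq))
      (subst (λ ts → Run _ _ ts _ _) (sym (act-idle ts)) (run-into {f = suc} (λ _ _ → refl) r′ s′)) , h₂
simulate {ts = ts} (exit {p} {c} eq) h =
  _ , last (cong (λ b → (if b then just (suc (entry c)) else nothing) , Vec.map idle (heads ts))
                 (trans (cong p (heads≡tops h)) eq)) ,
  subst (_ ⊩_) (sym (act-idle ts)) h

-- The exit transition of `next` still carries actions, whereas a verdict of `δ` carries none. The
-- additional state `zero` is entered by the exit and reads the verdict off the heads in one more
-- step.
machine : Cmd → (Vec Sym 4 → Bool) → TuringMachine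
machine c verdict = record
  { states = suc (count c) ; aux = 0 ; workTapes = 3 ; start = suc (entry c) ; δ = δ }
  where
  continue : Target (count c) → Bool ⊎ (Fin (suc (count c)) × Vec Action 4)
  continue (just q  , as) = inj₂ (suc q , as)
  continue (nothing , as) = inj₂ (zero , as)
  δ : Fin (suc (count c)) → Vec Sym 4 → Bool ⊎ (Fin (suc (count c)) × Vec Action 4)
  δ zero    hs = inj₁ (verdict hs)
  δ (suc q) hs = continue (next c q hs)

module _ {c : Cmd} {verdict : Vec Sym 4 → Bool} where

  run-machine : ∀ {q ts n ts′ k} → Run (next c) q ts n ts′ →
    run (machine c verdict) (n + k) (suc q , ts) ≡ run (machine c verdict) k (zero , ts′)
  run-machine (last eq)   rewrite eq = refl
  run-machine (more eq r) rewrite eq = run-machine r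

  input : List Bool → Store
  input w = List.map bit w ∷ [] ∷ [] ∷ [] ∷ []

  holds-input : ∀ w → input w ⊩ proj₂ (initial (machine c verdict) w)
  holds-input w = cells w ∷ holds 1 refl ∷ holds 1 refl ∷ holds 1 refl ∷ []
    where
    cells : ∀ w → Holds (List.map bit w) (fromCells (List.map bit w))
    cells []      = holds 1 refl
    cells (b ∷ w) = holds 0 (cong (bit b ∷_) (sym (++-identityʳ (List.map bit w))))

  -- The `suc` pays for the verdict step; the arbitrary `k` absorbs the surplus of a time bound over
  -- the actual running time.
  machine-decides : ∀ {w n σ} k → c ⊢ input w ⇓[ n ] σ →
    run (machine c verdict) (n + suc k) (initial (machine c verdict) w) ≡ just (verdict (tops σ))
  machine-decides {w} k r with simulate r (holds-input w)
  ... | _ , r′ , h = trans (run-machine r′) (cong (λ hs → just (verdict hs)) (heads≡tops h))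

retime : ∀ {c σ m n σ′} → m ≡ n → c ⊢ σ ⇓[ m ] σ′ → c ⊢ σ ⇓[ n ] σ′
retime refl r = r

-- Executions within a time bound

infix 4 _⊢_⟶[_]_

record _⊢_⟶[_]_ (c : Cmd) (σ : Store) (N : ℕ) (σ′ : Store) : Set where
  constructor within
  field
    {time} : ℕ
    bound  : time ≤ N
    exec   : c ⊢ σ ⇓[ time ] σ′

exactly : ∀ {c σ n σ′} → c ⊢ σ ⇓[ n ] σ′ → c ⊢ σ ⟶[ n ] σ′
exactly r = within ≤-refl r

weaken : ∀ {c σ m n σ′} → m ≤ n → c ⊢ σ ⟶[ m ] σ′ → c ⊢ σ ⟶[ n ] σ′
weaken m≤n (within b r) = within (≤-trans b m≤n) r

infixr 5 _⨟′_

_⨟′_ : ∀ {c d σ σ₁ σ₂ m n} → c ⊢ σ ⟶[ m ] σ₁ → d ⊢ σ₁ ⟶[ n ] σ₂ → c ⨟ d ⊢ σ ⟶[ m + n ] σ₂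
within b r ⨟′ within b′ s = within (+-mono-≤ b b′) (seq r s)

retarget : ∀ {c σ n σ₁ σ₂} → σ₁ ≡ σ₂ → c ⊢ σ ⟶[ n ] σ₁ → c ⊢ σ ⟶[ n ] σ₂
retarget refl r = r

branch-yes : ∀ {p c d σ n σ′} → p (tops σ) ≡ true → c ⊢ σ ⟶[ n ] σ′ → branch p c d ⊢ σ ⟶[ suc n ] σ′
branch-yes eq (within b r) = within (s≤s b) (if-yes eq r)

branch-no : ∀ {p c d σ n σ′} → p (tops σ) ≡ false → d ⊢ σ ⟶[ n ] σ′ → branch p c d ⊢ σ ⟶[ suc n ] σ′
branch-no eq (within b r) = within (s≤s b) (if-no eq r)

push₀ : ∀ {s st a b c} → push 0F s ⊢ st ∷ a ∷ b ∷ c ∷ [] ⟶[ 2 ] (s ∷ st) ∷ a ∷ b ∷ c ∷ []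
push₀ = exactly push

pop₀ : ∀ {s st a b c} → pop 0F ⊢ (s ∷ st) ∷ a ∷ b ∷ c ∷ [] ⟶[ 1 ] st ∷ a ∷ b ∷ c ∷ []
pop₀ = exactly pop

-- Moving bit strings and encoded trees between stacks

infixr 5 _▸_

_▸_ : List Bool → Stack → Stack
[]       ▸ st = st
(b ∷ bs) ▸ st = bit b ∷ (bs ▸ st)

▸-++ : ∀ xs {ys st} → (xs ++ ys) ▸ st ≡ xs ▸ ys ▸ st
▸-++ []       = refl
▸-++ (x ∷ xs) = cong (bit x ∷_) (▸-++ xs)

▸-[] : ∀ xs → List.map bit xs ≡ xs ▸ []
▸-[] []       = refl
▸-[] (x ∷ xs) = cong (bit x ∷_) (▸-[] xs)

isBit isTrue : Fin 4 → Vec Sym 4 → Bool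
isBit i hs with lookup hs i
... | bit _ = true
... | _     = false
isTrue i hs with lookup hs i
... | bit b = b
... | _     = false

-- In the parameters below, `at a o` is the store with source stack `a` after the output `o`.
-- Leaving its form open lets one loop serve for reversing a stack onto another one and, with `skip`
-- as `emit`, for erasing it.
module Transfer (i : Fin 4) (emit : Bool → Cmd) where

  body : Cmd
  body = branch (isTrue i) (pop i ⨟ emit true) (pop i ⨟ emit false)

  transfer : Cmd
  transfer = while (isBit i) body

  module _ (k : ℕ) (at : Stack → List Bool → Store)
           (at-top : ∀ a o → lookup (tops (at a o)) i ≡ top a)
           (at-pop : ∀ a o → updateAt (at a o) i pop′ ≡ at (pop′ a) o)
           (emits : ∀ b a o → emit b ⊢ at a o ⇓[ k ] at a (b ∷ o)) where

    transfers : ∀ bs {o} → transfer ⊢ at (bs ▸ []) o ⇓[ suc (length bs * (3 + k)) ] at [] (bs ʳ++ o)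
    transfers [] {o} = exit going
      where
      going : isBit i (tops (at [] o)) ≡ false
      going rewrite at-top [] o = refl
    transfers (b ∷ bs) {o} =
      retime (cong suc (+-suc (2 + k) (length bs * (3 + k))))
             (loop going (once b refl) (transfers bs))
      where
      going : isBit i (tops (at (bit b ∷ (bs ▸ [])) o)) ≡ true
      going rewrite at-top (bit b ∷ (bs ▸ [])) o = refl
      choice : isTrue i (tops (at (bit b ∷ (bs ▸ [])) o)) ≡ b
      choice rewrite at-top (bit b ∷ (bs ▸ [])) o = refl
      popped : pop i ⊢ at (bit b ∷ (bs ▸ [])) o ⇓[ 1 ] at (bs ▸ []) o
      popped = subst (λ σ → pop i ⊢ at (bit b ∷ (bs ▸ [])) o ⇓[ 1 ] σ) (at-pop (bit b ∷ (bs ▸ [])) o) pop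
      once : ∀ b′ → b ≡ b′ → body ⊢ at (bit b ∷ (bs ▸ [])) o ⇓[ 2 + k ] at (bs ▸ []) (b ∷ o)
      once true  refl = if-yes choice (seq popped (emits true _ o))
      once false refl = if-no choice (seq popped (emits false _ o))

-- A tree is cut off stack 0 by counting, on stack 3, the vertices that
-- have been entered but not left.

module Take (emit : Bool → Cmd) where

  scan : Cmd
  scan = while (isBit 3F) (branch (isTrue 0F) (pop 0F ⨟ push 3F (bit true) ⨟ emit true)
                                              (pop 0F ⨟ pop 3F ⨟ emit false))

  take : Cmd
  take = (pop 0F ⨟ push 3F (bit true) ⨟ emit true) ⨟ scan

  module _ (k : ℕ) (a b : List Bool → Stack)
           (emits : ∀ β s c o → emit β ⊢ s ∷ a o ∷ b o ∷ c ∷ [] ⇓[ k ]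
                                         s ∷ a (β ∷ o) ∷ b (β ∷ o) ∷ c ∷ []) where

    private
      store : Stack → List Bool → Stack → Store
      store s o c = s ∷ a o ∷ b o ∷ c ∷ []

    -- The first summand is for the opening bit: loop test, branch, pop, the two steps of a push,
    -- and `emit`. For the closing bit the push is replaced by a pop of the counter, which takes one
    -- step.
    vertexCost : ℕ
    vertexCost = (5 + k) + (4 + k)

    leave : ∀ {st o c n τ} → scan ⊢ store st (false ∷ o) c ⇓[ n ] τ →
            scan ⊢ store (bit false ∷ st) o (bit true ∷ c) ⇓[ 4 + k + n ] τ
    leave r = loop refl (if-no refl (seq pop (seq pop (emits false _ _ _)))) r

    enter : ∀ {st o c n τ} → scan ⊢ store st (true ∷ o) (bit true ∷ bit true ∷ c) ⇓[ n ] τ →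
            scan ⊢ store (bit true ∷ st) o (bit true ∷ c) ⇓[ 5 + k + n ] τ
    enter r = loop refl (if-yes refl (seq pop (seq push (emits true _ _ _)))) r

    mutual
      -- The loop does not stop at the end of `t`, since an enclosing vertex is still open: the
      -- counter is `bit true ∷ c`. The statement therefore takes the rest of the run as a premise
      -- and extends it at the front.
      scans : ∀ t {st o c n τ} → scan ⊢ store st (encode t ʳ++ o) (bit true ∷ c) ⇓[ n ] τ →
              scan ⊢ store (encode t ▸ st) o (bit true ∷ c) ⇓[ size t * vertexCost + n ] τ
      scans (node ts) {st} {o} {n = n} {τ} r
        rewrite ++-ʳ++ (encode* ts) {[ false ]} {true ∷ o} | ▸-++ (encode* ts) {[ false ]} {st} =
          retime (rearrange k (size* ts * vertexCost) n) (enter (scans* ts (leave r)))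
        where
        rearrange : ∀ k s n → 5 + k + (s + (4 + k + n)) ≡ (5 + k + (4 + k) + s) + n
        rearrange = solve-∀

      scans* : ∀ ts {st o c n τ} → scan ⊢ store st (encode* ts ʳ++ o) (bit true ∷ c) ⇓[ n ] τ →
               scan ⊢ store (encode* ts ▸ st) o (bit true ∷ c) ⇓[ size* ts * vertexCost + n ] τ
      scans* []       r = r
      scans* (t ∷ ts) {st} {o} {n = n} {τ} r
        rewrite ++-ʳ++ (encode t) {encode* ts} {o} | ▸-++ (encode t) {encode* ts} {st} =
          retime (rearrange (size t) (size* ts) vertexCost n) (scans t (scans* ts r))
        where
        rearrange : ∀ a b v n → a * v + (b * v + n) ≡ (a + b) * v + n
        rearrange = solve-∀

    -- The opening bit of the root is processed before the loop, which would stop at once on an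
    -- empty counter. This saves a loop test and a branch and is charged one loop exit, leaving a
    -- slack of one step.
    takes : ∀ t {st o} → take ⊢ store (encode t ▸ st) o [] ⟶[ size t * vertexCost ] store st (encode t ʳ++ o) []
    takes (node ts) {st} {o}
      rewrite ++-ʳ++ (encode* ts) {[ false ]} {true ∷ o} | ▸-++ (encode* ts) {[ false ]} {st} =
        weaken (subst₂ _≤_ (sym (lhs k (size* ts * vertexCost))) (sym (rhs k (size* ts * vertexCost))) (n≤1+n _))
          (exactly (seq (seq pop (seq push (emits true _ _ _))) (scans* ts (leave (exit refl)))))
      where
      lhs : ∀ k s → (3 + k) + (s + (4 + k + 1)) ≡ 8 + (k + k) + s
      lhs = solve-∀
      rhs : ∀ k s → 5 + k + (4 + k) + s ≡ 9 + (k + k) + s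
      rhs = solve-∀

mutual
  length-encode : ∀ t → length (encode t) ≡ 2 * size t
  length-encode (node ts) = begin
    suc (length (encode* ts ++ [ false ])) ≡⟨ cong suc (length-++ (encode* ts)) ⟩
    suc (length (encode* ts) + 1)          ≡⟨ cong (λ n → suc (n + 1)) (length-encode* ts) ⟩
    suc (2 * size* ts + 1)                 ≡⟨ rearrange (size* ts) ⟩
    2 * suc (size* ts)                     ∎
    where
    open ≡-Reasoning
    rearrange : ∀ n → suc (2 * n + 1) ≡ 2 * suc n
    rearrange = solve-∀

  length-encode* : ∀ ts → length (encode* ts) ≡ 2 * size* ts
  length-encode* []       = refl
  length-encode* (t ∷ ts) = begin
    length (encode t ++ encode* ts)         ≡⟨ length-++ (encode t) ⟩
    length (encode t) + length (encode* ts) ≡⟨ cong₂ _+_ (length-encode t) (length-encode* ts) ⟩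
    2 * size t + 2 * size* ts               ≡⟨ *-distribˡ-+ 2 (size t) (size* ts) ⟨
    2 * (size t + size* ts)                 ∎
    where open ≡-Reasoning

rev : Tree → List Bool
rev t = encode t ʳ++ []

length-rev : ∀ t → length (rev t) ≡ 2 * size t
length-rev t = trans (length-ʳ++ (encode t)) (trans (+-identityʳ _) (length-encode t))

rev-rev : ∀ t → rev t ʳ++ [] ≡ encode t
rev-rev t = trans (ʳ++-ʳ++ (encode t)) (++-identityʳ (encode t))

encode-∷ : ∀ t ts {st} → encode (node (t ∷ ts)) ▸ st ≡ bit true ∷ encode t ▸ (encode* ts ++ [ false ]) ▸ st
encode-∷ t ts {st} = cong (bit true ∷_) (begin
  ((encode t ++ encode* ts) ++ [ false ]) ▸ st ≡⟨ cong (_▸ st) (++-assoc (encode t) (encode* ts) [ false ]) ⟩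
  (encode t ++ encode* ts ++ [ false ]) ▸ st   ≡⟨ ▸-++ (encode t) ⟩
  encode t ▸ (encode* ts ++ [ false ]) ▸ st    ∎)
  where open ≡-Reasoning

module TakeA  = Take (λ b → push 1F (bit b))
module TakeB  = Take (λ b → push 2F (bit b))
module TakeAB = Take (λ b → push 1F (bit b) ⨟ push 2F (bit b))
module Drop   = Take (λ _ → skip)

module AS = Transfer 1F (λ b → push 0F (bit b))
module BS = Transfer 2F (λ b → push 0F (bit b))
module AB = Transfer 1F (λ b → push 2F (bit b))
module A∅ = Transfer 1F (λ _ → skip)
module B∅ = Transfer 2F (λ _ → skip)

-- The factors 13, 17 and 11 here and below are `vertexCost` for an `emit` of cost 2, 4 and 1.
takeA : ∀ t {st b} → TakeA.take ⊢ (encode t ▸ st) ∷ [] ∷ b ∷ [] ∷ [] ⟶[ size t * 13 ] st ∷ (rev t ▸ []) ∷ b ∷ [] ∷ []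
takeA t {b = b} = TakeA.takes 2 (_▸ []) (λ _ → b) (λ _ _ _ _ → push) t

takeB : ∀ t {st a} → TakeB.take ⊢ (encode t ▸ st) ∷ a ∷ [] ∷ [] ∷ [] ⟶[ size t * 13 ] st ∷ a ∷ (rev t ▸ []) ∷ [] ∷ []
takeB t {a = a} = TakeB.takes 2 (λ _ → a) (_▸ []) (λ _ _ _ _ → push) t

takeAB : ∀ t {st} → TakeAB.take ⊢ (encode t ▸ st) ∷ [] ∷ [] ∷ [] ∷ [] ⟶[ size t * 17 ]
                                  st ∷ (rev t ▸ []) ∷ (rev t ▸ []) ∷ [] ∷ []
takeAB t = TakeAB.takes 4 (_▸ []) (_▸ []) (λ _ _ _ _ → seq push push) t

drop : ∀ t {st a b} → Drop.take ⊢ (encode t ▸ st) ∷ a ∷ b ∷ [] ∷ [] ⟶[ size t * 11 ] st ∷ a ∷ b ∷ [] ∷ []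
drop t {a = a} {b} = Drop.takes 1 (λ _ → a) (λ _ → b) (λ _ _ _ _ → skip) t {o = []}

moveAS : ∀ bs {s b c} → AS.transfer ⊢ s ∷ (bs ▸ []) ∷ b ∷ c ∷ [] ⇓[ suc (length bs * 5) ]
                                      ((bs ʳ++ []) ▸ s) ∷ [] ∷ b ∷ c ∷ []
moveAS bs {s} {b} {c} =
  AS.transfers 2 (λ a o → (o ▸ s) ∷ a ∷ b ∷ c ∷ []) (λ _ _ → refl) (λ _ _ → refl) (λ _ _ _ → push) bs

moveBS : ∀ bs {s a c} → BS.transfer ⊢ s ∷ a ∷ (bs ▸ []) ∷ c ∷ [] ⇓[ suc (length bs * 5) ]
                                      ((bs ʳ++ []) ▸ s) ∷ a ∷ [] ∷ c ∷ []
moveBS bs {s} {a} {c} =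
  BS.transfers 2 (λ b o → (o ▸ s) ∷ a ∷ b ∷ c ∷ []) (λ _ _ → refl) (λ _ _ → refl) (λ _ _ _ → push) bs

moveAB : ∀ bs {s c} → AB.transfer ⊢ s ∷ (bs ▸ []) ∷ [] ∷ c ∷ [] ⇓[ suc (length bs * 5) ]
                                    s ∷ [] ∷ ((bs ʳ++ []) ▸ []) ∷ c ∷ []
moveAB bs {s} {c} =
  AB.transfers 2 (λ a o → s ∷ a ∷ (o ▸ []) ∷ c ∷ []) (λ _ _ → refl) (λ _ _ → refl) (λ _ _ _ → push) bs

clearA : ∀ bs {s b c} → A∅.transfer ⊢ s ∷ (bs ▸ []) ∷ b ∷ c ∷ [] ⇓[ suc (length bs * 4) ] s ∷ [] ∷ b ∷ c ∷ []
clearA bs {s} {b} {c} =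
  A∅.transfers 1 (λ a _ → s ∷ a ∷ b ∷ c ∷ []) (λ _ _ → refl) (λ _ _ → refl) (λ _ _ _ → skip) bs {[]}

clearB : ∀ bs {s a c} → B∅.transfer ⊢ s ∷ a ∷ (bs ▸ []) ∷ c ∷ [] ⇓[ suc (length bs * 4) ] s ∷ a ∷ [] ∷ c ∷ []
clearB bs {s} {a} {c} =
  B∅.transfers 1 (λ b _ → s ∷ a ∷ b ∷ c ∷ []) (λ _ _ → refl) (λ _ _ → refl) (λ _ _ _ → skip) bs {[]}

≤-slack : ∀ {m n} k → m + k ≡ n → m ≤ n
≤-slack {m} k refl = m≤m+n m k

restoreCost : ∀ t → suc (length (rev t) * 5) ≤ 11 * size t
restoreCost t@(node ts) rewrite length-rev t = ≤-slack (size* ts) (rearrange (size* ts))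
  where
  rearrange : ∀ n → suc (2 * suc n * 5) + n ≡ 11 * suc n
  rearrange = solve-∀

restoreA : ∀ t {s b c} → AS.transfer ⊢ s ∷ (rev t ▸ []) ∷ b ∷ c ∷ [] ⟶[ 11 * size t ] (encode t ▸ s) ∷ [] ∷ b ∷ c ∷ []
restoreA t {s} {b} {c} =
  subst (λ bs → AS.transfer ⊢ s ∷ (rev t ▸ []) ∷ b ∷ c ∷ [] ⟶[ 11 * size t ] (bs ▸ s) ∷ [] ∷ b ∷ c ∷ [])
        (rev-rev t) (within (restoreCost t) (moveAS (rev t)))

restoreB : ∀ t {s a c} → BS.transfer ⊢ s ∷ a ∷ (rev t ▸ []) ∷ c ∷ [] ⟶[ 11 * size t ] (encode t ▸ s) ∷ a ∷ [] ∷ c ∷ []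
restoreB t {s} {a} {c} =
  subst (λ bs → BS.transfer ⊢ s ∷ a ∷ (rev t ▸ []) ∷ c ∷ [] ⟶[ 11 * size t ] (bs ▸ s) ∷ a ∷ [] ∷ c ∷ [])
        (rev-rev t) (within (restoreCost t) (moveBS (rev t)))

-- Primitive operations on encoded trees

main : Stack → Store
main s = s ∷ [] ∷ [] ∷ [] ∷ []

starts-true : ∀ t {st} → isTrue 0F (tops (main (encode t ▸ st))) ≡ true
starts-true (node _) = refl

dup swapTop consTop hdTop tlTop nilTop : Cmd
dup     = TakeAB.take ⨟ AS.transfer ⨟ BS.transfer
swapTop = TakeA.take ⨟ TakeB.take ⨟ AS.transfer ⨟ BS.transfer
consTop = TakeA.take ⨟ pop 0F ⨟ AS.transfer ⨟ push 0F (bit true)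
hdTop   = pop 0F ⨟ branch (isTrue 0F) (TakeA.take ⨟ push 0F (bit true) ⨟ Drop.take ⨟ AS.transfer) (push 0F (bit true))
tlTop   = pop 0F ⨟ branch (isTrue 0F) (Drop.take ⨟ push 0F (bit true)) (push 0F (bit true))
nilTop  = Drop.take ⨟ push 0F (bit false) ⨟ push 0F (bit true)

infixr 5 _∷ᵀ_

_∷ᵀ_ : Tree → Tree → Tree
t ∷ᵀ node ts = node (t ∷ ts)

hd tl : Tree → Tree
hd (node [])      = 𝟏
hd (node (t ∷ _)) = t
tl (node [])       = 𝟏
tl (node (_ ∷ ts)) = node ts

-- The factor 40 is a common upper bound for all primitives; each `rearrange` exhibits the
-- difference from the actual sum.
dups : ∀ t {st} → dup ⊢ main (encode t ▸ st) ⟶[ 40 * size t ] main (encode t ▸ encode t ▸ st)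
dups t = weaken (≤-slack (size t) (rearrange (size t))) (takeAB t ⨟′ restoreA t ⨟′ restoreB t)
  where
  rearrange : ∀ n → (n * 17 + (11 * n + 11 * n)) + n ≡ 40 * n
  rearrange = solve-∀

swaps : ∀ t u {st} → swapTop ⊢ main (encode t ▸ encode u ▸ st) ⟶[ 40 * (size t + size u) ] main (encode u ▸ encode t ▸ st)
swaps t u = weaken (≤-slack _ (rearrange (size t) (size u))) (takeA t ⨟′ takeB u ⨟′ restoreA t ⨟′ restoreB u)
  where
  rearrange : ∀ m n → (m * 13 + (n * 13 + (11 * m + 11 * n))) + (16 * m + 16 * n) ≡ 40 * (m + n)
  rearrange = solve-∀

conses : ∀ t u {st} → consTop ⊢ main (encode t ▸ encode u ▸ st) ⟶[ 40 * (size t + size u) ] main (encode (t ∷ᵀ u) ▸ st)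
conses t (node us) =
  retarget (cong main (sym (encode-∷ t us)))
    (weaken (≤-slack _ (rearrange (size t) (size* us))) (takeA t ⨟′ pop₀ ⨟′ restoreA t ⨟′ push₀))
  where
  rearrange : ∀ m n → (m * 13 + (1 + (11 * m + 2))) + (37 + 16 * m + 40 * n) ≡ 40 * (m + suc n)
  rearrange = solve-∀

hds : ∀ t {st} → hdTop ⊢ main (encode t ▸ st) ⟶[ 40 * size t ] main (encode (hd t) ▸ st)
hds (node []) = weaken (≤-slack 36 refl) (pop₀ ⨟′ branch-no refl push₀)
hds (node (t ∷ ts)) {st} rewrite encode-∷ t ts {st} =
  weaken (≤-slack _ (rearrange (size t) (size* ts)))
    (pop₀ ⨟′ branch-yes (starts-true t) (takeA t ⨟′ push₀ ⨟′ drop (node ts) ⨟′ restoreA t))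
  where
  rearrange : ∀ m n → (1 + suc (m * 13 + (2 + (suc n * 11 + 11 * m)))) + (25 + 16 * m + 29 * n) ≡ 40 * suc (m + n)
  rearrange = solve-∀

tls : ∀ t {st} → tlTop ⊢ main (encode t ▸ st) ⟶[ 40 * size t ] main (encode (tl t) ▸ st)
tls (node []) = weaken (≤-slack 36 refl) (pop₀ ⨟′ branch-no refl push₀)
tls (node (t ∷ ts)) {st} rewrite encode-∷ t ts {st} =
  weaken (≤-slack _ (rearrange (size t) (size* ts)))
    (pop₀ ⨟′ branch-yes (starts-true t) (drop t ⨟′ push₀))
  where
  rearrange : ∀ m n → (1 + suc (m * 11 + 2)) + (36 + 29 * m + 40 * n) ≡ 40 * suc (m + n)
  rearrange = solve-∀

nils : ∀ t {st} → nilTop ⊢ main (encode t ▸ st) ⟶[ 40 * size t ] main (encode 𝟏 ▸ st)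
nils (node ts) = weaken (≤-slack _ (rearrange (size* ts))) (drop (node ts) ⨟′ push₀ ⨟′ push₀)
  where
  rearrange : ∀ n → (suc n * 11 + 4) + (25 + 29 * n) ≡ 40 * suc n
  rearrange = solve-∀

-- Polynomial bounds and polynomial-time functions on trees

Poly : (Tree → ℕ) → Set
Poly g = ∃[ k ] ∀ x → g x ≤ (2 + size x) ^ k

1≤power : ∀ s k → 1 ≤ (2 + s) ^ k
1≤power s k = m^n>0 (2 + s) k

-- This is the reason for the base `2 + size x`: being at least 2, it absorbs the doubling caused by
-- a sum into one more factor, so that a bound is a bare exponent without coefficients.
double : ∀ s m → 2 * m ≤ (2 + s) * m
double s m = *-monoˡ-≤ m (m≤m+n 2 s)

≤-poly : ∀ {f g} → (∀ x → f x ≤ g x) → Poly g → Poly f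
≤-poly f≤g (k , b) = k , λ x → ≤-trans (f≤g x) (b x)

infixl 6 _⊕_
infixl 7 _⊗_

abstract

  const-poly : ∀ n → Poly (λ _ → n)
  const-poly n = n , λ x → bound (size x) n
    where
    bound : ∀ s n → n ≤ (2 + s) ^ n
    bound s zero    = z≤n
    bound s (suc n) = begin
      1 + n                         ≤⟨ +-mono-≤ (1≤power s n) (bound s n) ⟩
      (2 + s) ^ n + (2 + s) ^ n     ≡⟨ cong ((2 + s) ^ n +_) (+-identityʳ _) ⟨
      2 * (2 + s) ^ n               ≤⟨ double s ((2 + s) ^ n) ⟩
      (2 + s) ^ suc n               ∎
      where open ≤-Reasoning

  size-poly : Poly size
  size-poly = 1 , λ x → ≤-trans (m≤n+m (size x) 2) (≤-reflexive (sym (*-identityʳ _)))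

  _⊕_ : ∀ {f g} → Poly f → Poly g → Poly (λ x → f x + g x)
  _⊕_ {f} {g} (j , p) (k , q) = suc (j + k) , λ x → begin
    f x + g x                                   ≤⟨ +-mono-≤ (p x) (q x) ⟩
    (2 + size x) ^ j + (2 + size x) ^ k         ≤⟨ +-mono-≤ (^-monoʳ-≤ (2 + size x) (m≤m+n j k)) (^-monoʳ-≤ (2 + size x) (m≤n+m k j)) ⟩
    (2 + size x) ^ (j + k) + (2 + size x) ^ (j + k) ≡⟨ cong ((2 + size x) ^ (j + k) +_) (+-identityʳ _) ⟨
    2 * (2 + size x) ^ (j + k)                  ≤⟨ double (size x) ((2 + size x) ^ (j + k)) ⟩
    (2 + size x) ^ suc (j + k)                  ∎
    where open ≤-Reasoning

  _⊗_ : ∀ {f g} → Poly f → Poly g → Poly (λ x → f x * g x)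
  _⊗_ {f} {g} (j , p) (k , q) = j + k , λ x → begin
    f x * g x                             ≤⟨ *-mono-≤ (p x) (q x) ⟩
    (2 + size x) ^ j * (2 + size x) ^ k   ≡⟨ ^-distribˡ-+-* (2 + size x) j k ⟨
    (2 + size x) ^ (j + k)                ∎
    where open ≤-Reasoning

  power-poly : ∀ {f} k → Poly f → Poly (λ x → (2 + f x) ^ k)
  -- Two additional factors absorb the summand 2, because `2 + m` is at most `4 * m` for positive
  -- `m`.
  power-poly {f} k (j , p) = (2 + j) * k , λ x → begin
    (2 + f x) ^ k                     ≤⟨ ^-monoˡ-≤ k (+-monoʳ-≤ 2 (p x)) ⟩
    (2 + (2 + size x) ^ j) ^ k        ≤⟨ ^-monoˡ-≤ k (absorb (size x) _ (1≤power (size x) j)) ⟩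
    ((2 + size x) ^ (2 + j)) ^ k      ≡⟨ ^-*-assoc (2 + size x) (2 + j) k ⟩
    (2 + size x) ^ ((2 + j) * k)      ∎
    where
    open ≤-Reasoning
    rearrange : ∀ m → 2 + suc m + (1 + 3 * m) ≡ 2 * (2 * suc m)
    rearrange = solve-∀
    absorb : ∀ s m → 1 ≤ m → 2 + m ≤ (2 + s) * ((2 + s) * m)
    absorb s (suc m) _ = begin
      2 + suc m                     ≤⟨ ≤-slack _ (rearrange m) ⟩
      2 * (2 * suc m)               ≤⟨ *-monoʳ-≤ 2 (double s (suc m)) ⟩
      2 * ((2 + s) * suc m)         ≤⟨ double s ((2 + s) * suc m) ⟩
      (2 + s) * ((2 + s) * suc m)   ∎

  ∘-poly : ∀ {g : Tree → ℕ} {f : Tree → Tree} → Poly g → Poly (λ x → size (f x)) → Poly (λ x → g (f x))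
  ∘-poly {f = f} (k , q) p = ≤-poly (λ x → q (f x)) (power-poly k p)

-- The code has to leave an arbitrary rest `st` of the stack intact, so that other values can be
-- kept below its argument. The size bound is what makes composition possible: the cost of the outer
-- function is measured in the size of the inner result.
record Computable (f : Tree → Tree) : Set where
  field
    code     : Cmd
    cost     : Tree → ℕ
    runs     : ∀ x {st} → code ⊢ main (encode x ▸ st) ⟶[ cost x ] main (encode (f x) ▸ st)
    costPoly : Poly cost
    sizePoly : Poly (λ x → size (f x))

open Computable

≗-computable : ∀ {f g} → (∀ x → f x ≡ g x) → Computable f → Computable g
≗-computable f≗g F = record
  { code     = code F
  ; cost     = cost F
  ; runs     = λ x {st} → retarget (cong (λ y → main (encode y ▸ st)) (f≗g x)) (runs F x)
  ; costPoly = costPoly F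
  ; sizePoly = ≤-poly (λ x → ≤-reflexive (cong size (sym (f≗g x)))) (sizePoly F)
  }

idᶜ : Computable id
idᶜ = record { code = skip ; cost = λ _ → 1 ; runs = λ _ → exactly skip ; costPoly = const-poly 1 ; sizePoly = size-poly }

infixr 9 _∘ᶜ_
_∘ᶜ_ : ∀ {g f} → Computable g → Computable f → Computable (λ x → g (f x))
_∘ᶜ_ {g} {f} G F = record
  { code     = code F ⨟ code G
  ; cost     = λ x → cost F x + cost G (f x)
  ; runs     = λ x → runs F x ⨟′ runs G (f x)
  ; costPoly = costPoly F ⊕ ∘-poly {f = f} (costPoly G) (sizePoly F)
  ; sizePoly = ∘-poly {f = f} (sizePoly G) (sizePoly F)
  }

𝟏ᶜ : Computable (λ _ → 𝟏)
𝟏ᶜ = record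
  { code = nilTop ; cost = λ x → 40 * size x ; runs = λ x → nils x
  ; costPoly = const-poly 40 ⊗ size-poly ; sizePoly = const-poly 1 }

size-hd : ∀ x → size (hd x) ≤ size x
size-hd (node [])       = ≤-refl
size-hd (node (t ∷ ts)) = ≤-trans (m≤m+n (size t) (size* ts)) (n≤1+n _)

size-tl : ∀ x → size (tl x) ≤ size x
size-tl (node [])       = ≤-refl
size-tl (node (t ∷ ts)) = s≤s (m≤n+m (size* ts) (size t))

size-∷ᵀ : ∀ t u → size (t ∷ᵀ u) ≡ size t + size u
size-∷ᵀ t (node us) = sym (+-suc (size t) (size* us))

hdᶜ : Computable hd
hdᶜ = record
  { code = hdTop ; cost = λ x → 40 * size x ; runs = λ x → hds x
  ; costPoly = const-poly 40 ⊗ size-poly ; sizePoly = ≤-poly size-hd size-poly }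

tlᶜ : Computable tl
tlᶜ = record
  { code = tlTop ; cost = λ x → 40 * size x ; runs = λ x → tls x
  ; costPoly = const-poly 40 ⊗ size-poly ; sizePoly = ≤-poly size-tl size-poly }

pairCode : Cmd → Cmd → Cmd
pairCode f g = dup ⨟ g ⨟ swapTop ⨟ f

pairCost : (f g : Tree → ℕ) (u : Tree → Tree) → Tree → ℕ
pairCost f g u x = 40 * size x + (g x + (40 * (size (u x) + size x) + f x))

pairs : ∀ {f g} (F : Computable f) (G : Computable g) x {st} →
  pairCode (code F) (code G) ⊢ main (encode x ▸ st) ⟶[ pairCost (cost F) (cost G) g x ]
  main (encode (f x) ▸ encode (g x) ▸ st)
pairs {f} {g} F G x = dups x ⨟′ runs G x ⨟′ swaps (g x) x ⨟′ runs F x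

pairCost-poly : ∀ {f g} (F : Computable f) (G : Computable g) → Poly (pairCost (cost F) (cost G) g)
pairCost-poly F G =
  const-poly 40 ⊗ size-poly ⊕ (costPoly G ⊕ (const-poly 40 ⊗ (sizePoly G ⊕ size-poly) ⊕ costPoly F))

infixr 5 _∷ᶜ_
_∷ᶜ_ : ∀ {f g} → Computable f → Computable g → Computable (λ x → f x ∷ᵀ g x)
_∷ᶜ_ {f} {g} F G = record
  { code     = pairCode (code F) (code G) ⨟ consTop
  ; cost     = λ x → pairCost (cost F) (cost G) g x + 40 * (size (f x) + size (g x))
  ; runs     = λ x → pairs F G x ⨟′ conses (f x) (g x)
  ; costPoly = pairCost-poly F G ⊕ const-poly 40 ⊗ (sizePoly F ⊕ sizePoly G)
  ; sizePoly = ≤-poly (λ x → ≤-reflexive (size-∷ᵀ (f x) (g x))) (sizePoly F ⊕ sizePoly G)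
  }

-- Counting every tree other than a leaf as true makes the same test decide whether a list is
-- nonempty and whether a divisor differs from `𝟏`.
truth : Tree → Bool
truth (node [])      = false
truth (node (_ ∷ _)) = true

fromBool : Bool → Tree
fromBool false = 𝟏
fromBool true  = node [ 𝟏 ]

truth-fromBool : ∀ b → truth (fromBool b) ≡ b
truth-fromBool false = refl
truth-fromBool true  = refl

size-fromBool : ∀ b → size (fromBool b) ≤ 2
size-fromBool false = s≤s z≤n
size-fromBool true  = ≤-refl

size-if : ∀ b t u → size (if b then t else u) ≤ size t + size u
size-if true  t u = m≤m+n (size t) (size u)
size-if false t u = m≤n+m (size u) (size t)

ifᶜ_then_else_ : ∀ {f g h} → Computable f → Computable g → Computable h →
                 Computable (λ x → if truth (f x) then g x else h x)
ifᶜ_then_else_ {f} {g} {h} F G H = record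
  { code     = dup ⨟ code F ⨟ pop 0F ⨟ branch (isTrue 0F) (push 0F (bit true) ⨟ Drop.take ⨟ code G) (pop 0F ⨟ code H)
  ; cost     = branchCost
  ; runs     = λ x → dups x ⨟′ runs F x ⨟′ choose x (f x)
  ; costPoly = const-poly 40 ⊗ size-poly ⊕ (costPoly F ⊕ (const-poly 4 ⊕ (sizePoly F ⊗ const-poly 11 ⊕ (costPoly G ⊕ costPoly H))))
  ; sizePoly = ≤-poly (λ x → size-if (truth (f x)) (g x) (h x)) (sizePoly G ⊕ sizePoly H)
  }
  where
  branchCost : Tree → ℕ
  branchCost x = 40 * size x + (cost F x + (4 + (size (f x) * 11 + (cost G x + cost H x))))
  choose : ∀ x y {st} → pop 0F ⨟ branch (isTrue 0F) (push 0F (bit true) ⨟ Drop.take ⨟ code G) (pop 0F ⨟ code H) ⊢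
    main (encode y ▸ encode x ▸ st) ⟶[ 4 + (size y * 11 + (cost G x + cost H x)) ]
    main (encode (if truth y then g x else h x) ▸ st)
  choose x y@(node []) = weaken (+-mono-≤ (n≤1+n 3) (m≤n⇒m≤o+n (size y * 11) (m≤n+m (cost H x) (cost G x))))
    (pop₀ ⨟′ branch-no refl (pop₀ ⨟′ runs H x))
  choose x y@(node (t ∷ ts)) {st} = weaken (+-monoʳ-≤ 4 (+-monoʳ-≤ (size y * 11) (m≤m+n (cost G x) (cost H x))))
    (pop₀ ⨟′ branch-yes (starts t) (push₀ ⨟′ drop y ⨟′ runs G x))
    where
    starts : ∀ t → isTrue 0F (tops (main ((encode* (t ∷ ts) ++ [ false ]) ▸ encode x ▸ st))) ≡ true
    starts (node _) = refl

-- Encodings are compared from their ends, since taking a tree off a stack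
-- reverses its encoding.

leq : List Bool → List Bool → Bool
leq []           ys           = true
leq (x ∷ xs)     []           = false
leq (false ∷ xs) (true ∷ ys)  = true
leq (true ∷ xs)  (false ∷ ys) = false
leq (false ∷ xs) (false ∷ ys) = leq xs ys
leq (true ∷ xs)  (true ∷ ys)  = leq xs ys

_≤ᵀ_ : Tree → Tree → Bool
t ≤ᵀ u = leq (rev t) (rev u)

agree leqTop : Sym → Sym → Bool
agree (bit true)  (bit true)  = true
agree (bit false) (bit false) = true
agree _           _           = false
leqTop (bit false) (bit true) = true
leqTop (bit _)     _          = false
leqTop _           _          = true

onAB : (Sym → Sym → Bool) → Vec Sym 4 → Bool
onAB p hs = p (lookup hs 1F) (lookup hs 2F)

strip : Cmd
strip = while (onAB agree) (pop 1F ⨟ pop 2F)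

-- Removing a common first bit does not change `leq`, so the tops at the first disagreement, or at
-- the end of a string, decide the comparison. The length bounds pay for clearing the remainders.
strips : ∀ xs ys {s} → ∃[ xs′ ] ∃[ ys′ ]
  strip ⊢ s ∷ (xs ▸ []) ∷ (ys ▸ []) ∷ [] ∷ [] ⟶[ 1 + length xs * 3 ] s ∷ (xs′ ▸ []) ∷ (ys′ ▸ []) ∷ [] ∷ [] ×
  leqTop (top (xs′ ▸ [])) (top (ys′ ▸ [])) ≡ leq xs ys × length xs′ ≤ length xs × length ys′ ≤ length ys
strips []           ys           = [] , ys , exactly (exit refl) , refl , ≤-refl , ≤-refl
strips (false ∷ xs) []           = false ∷ xs , [] , within (s≤s z≤n) (exit refl) , refl , ≤-refl , ≤-refl
strips (true ∷ xs)  []           = true ∷ xs , [] , within (s≤s z≤n) (exit refl) , refl , ≤-refl , ≤-refl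
strips (false ∷ xs) (true ∷ ys)  = false ∷ xs , true ∷ ys , within (s≤s z≤n) (exit refl) , refl , ≤-refl , ≤-refl
strips (true ∷ xs)  (false ∷ ys) = true ∷ xs , false ∷ ys , within (s≤s z≤n) (exit refl) , refl , ≤-refl , ≤-refl
strips (false ∷ xs) (false ∷ ys) with strips xs ys
... | xs′ , ys′ , within b r , eq , p , q =
  xs′ , ys′ , within (+-monoʳ-≤ 3 b) (loop refl (seq pop pop) r) , eq , m≤n⇒m≤1+n p , m≤n⇒m≤1+n q
strips (true ∷ xs)  (true ∷ ys)  with strips xs ys
... | xs′ , ys′ , within b r , eq , p , q =
  xs′ , ys′ , within (+-monoʳ-≤ 3 b) (loop refl (seq pop pop) r) , eq , m≤n⇒m≤1+n p , m≤n⇒m≤1+n q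

put : Bool → Cmd
put false = push 0F (bit false) ⨟ push 0F (bit true)
put true  = push 0F (bit false) ⨟ push 0F (bit false) ⨟ push 0F (bit true) ⨟ push 0F (bit true)

puts : ∀ b {st} → put b ⊢ main st ⟶[ 8 ] main (encode (fromBool b) ▸ st)
puts false = weaken (≤-slack 4 refl) (push₀ ⨟′ push₀)
puts true  = push₀ ⨟′ push₀ ⨟′ push₀ ⨟′ push₀

compareᵀ : Cmd
compareᵀ = TakeA.take ⨟ TakeB.take ⨟ strip ⨟
  branch (onAB leqTop) (A∅.transfer ⨟ B∅.transfer ⨟ put true) (A∅.transfer ⨟ B∅.transfer ⨟ put false)

compares : ∀ t u {st} → compareᵀ ⊢ main (encode t ▸ encode u ▸ st) ⟶[ 40 * (size t + size u) ]
                                   main (encode (fromBool (t ≤ᵀ u)) ▸ st)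
compares t@(node ts) u@(node us) {st} with strips (rev t) (rev u) {st}
... | xs , ys , r , eq , p , q =
  weaken (≤-slack _ (rearrange (size* ts) (size* us)))
    (takeA t ⨟′ takeB u ⨟′ weaken (+-monoʳ-≤ 1 (*-monoˡ-≤ 3 (≤-reflexive (length-rev t)))) r ⨟′ verdict _ eq)
  where
  clear : ∀ b → A∅.transfer ⨟ B∅.transfer ⨟ put b ⊢ st ∷ (xs ▸ []) ∷ (ys ▸ []) ∷ [] ∷ []
          ⟶[ suc (2 * size t * 4) + (suc (2 * size u * 4) + 8) ] main (encode (fromBool b) ▸ st)
  clear b = within (s≤s (*-monoˡ-≤ 4 (≤-trans p (≤-reflexive (length-rev t))))) (clearA xs) ⨟′
            within (s≤s (*-monoˡ-≤ 4 (≤-trans q (≤-reflexive (length-rev u))))) (clearB ys) ⨟′ puts b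
  verdict : ∀ b → leqTop (top (xs ▸ [])) (top (ys ▸ [])) ≡ b →
    branch (onAB leqTop) (A∅.transfer ⨟ B∅.transfer ⨟ put true) (A∅.transfer ⨟ B∅.transfer ⨟ put false) ⊢
      st ∷ (xs ▸ []) ∷ (ys ▸ []) ∷ [] ∷ []
    ⟶[ suc (suc (2 * size t * 4) + (suc (2 * size u * 4) + 8)) ] main (encode (fromBool b) ▸ st)
  verdict true  eq = branch-yes eq (clear true)
  verdict false eq = branch-no eq (clear false)
  rearrange : ∀ m n → suc m * 13 + (suc n * 13 + ((1 + 2 * suc m * 3) + suc (suc (2 * suc m * 4) + (suc (2 * suc n * 4) + 8))))
                      + (20 + 13 * m + 19 * n) ≡ 40 * (suc m + suc n)
  rearrange = solve-∀

infix 5 _≤ᶜ_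
_≤ᶜ_ : ∀ {f g} → Computable f → Computable g → Computable (λ x → fromBool (f x ≤ᵀ g x))
_≤ᶜ_ {f} {g} F G = record
  { code     = pairCode (code F) (code G) ⨟ compareᵀ
  ; cost     = λ x → pairCost (cost F) (cost G) g x + 40 * (size (f x) + size (g x))
  ; runs     = λ x → pairs F G x ⨟′ compares (f x) (g x)
  ; costPoly = pairCost-poly F G ⊕ const-poly 40 ⊗ (sizePoly F ⊕ sizePoly G)
  ; sizePoly = ≤-poly (λ x → size-fromBool (f x ≤ᵀ g x)) (const-poly 2)
  }

-- Iteration over the bits of an encoding, from the last one to the first one

select : (f g : Tree → Tree) → Bool → Tree → Tree
select f g b s = if b then f s else g s

-- Every intermediate state has to be bounded, not only the last one: steps of polynomial cost could
-- otherwise make the state grow exponentially when repeated.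
Throughout : (Tree → Set) → (Bool → Tree → Tree) → Tree → List Bool → Set
Throughout P step s []       = P s
Throughout P step s (b ∷ bs) = P (foldr step s (b ∷ bs)) × Throughout P step s bs

throughout-end : ∀ {P step s} bs → Throughout P step s bs → P (foldr step s bs)
throughout-end []       p       = p
throughout-end (b ∷ bs) (p , _) = p

module Iteration {f g i c : Tree → Tree} (F : Computable f) (G : Computable g)
                 (I : Computable i) (C : Computable c) where

  iterate : Tree → List Bool → Tree
  iterate = foldr (select f g)

  roundCost : Tree → ℕ
  roundCost s = 11 * size s + (cost F s + cost G s + (size (f s) + size (g s)) * 13)

  roundCost-poly : Poly roundCost
  roundCost-poly = const-poly 11 ⊗ size-poly ⊕ (costPoly F ⊕ costPoly G ⊕ (sizePoly F ⊕ sizePoly G) ⊗ const-poly 13)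

  rounds : Cmd
  rounds = while (isBit 0F) (branch (isTrue 0F) (pop 0F ⨟ AS.transfer ⨟ code F ⨟ TakeA.take)
                                                (pop 0F ⨟ AS.transfer ⨟ code G ⨟ TakeA.take))

  -- The unread bits lie above a blank, and the state waits on stack 1 while the
  -- next bit is inspected.

  suspended : List Bool → Stack → Tree → Store
  suspended w st s = (w ▸ blank ∷ st) ∷ (rev s ▸ []) ∷ [] ∷ [] ∷ []

  round : ∀ b s {w st} → branch (isTrue 0F) (pop 0F ⨟ AS.transfer ⨟ code F ⨟ TakeA.take)
                                            (pop 0F ⨟ AS.transfer ⨟ code G ⨟ TakeA.take) ⊢
          suspended (b ∷ w) st s ⟶[ 2 + roundCost s ] suspended w st (select f g b s)
  round true s = weaken
    (+-monoʳ-≤ 2 (+-monoʳ-≤ (11 * size s) (+-mono-≤ (m≤m+n (cost F s) (cost G s)) (*-monoˡ-≤ 13 (m≤m+n (size (f s)) (size (g s)))))))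
    (branch-yes refl (pop₀ ⨟′ restoreA s ⨟′ runs F s ⨟′ takeA (f s)))
  round false s = weaken
    (+-monoʳ-≤ 2 (+-monoʳ-≤ (11 * size s) (+-mono-≤ (m≤n+m (cost G s) (cost F s)) (*-monoˡ-≤ 13 (m≤n+m (size (g s)) (size (f s)))))))
    (branch-no refl (pop₀ ⨟′ restoreA s ⨟′ runs G s ⨟′ takeA (g s)))

  roundsCost : Tree → List Bool → ℕ
  roundsCost s []       = 0
  roundsCost s (b ∷ bs) = 3 + roundCost (iterate s bs) + roundsCost s bs

  -- `foldr` consumes the last bit first, hence the reversed bits on the stack. The premise is the
  -- run after the bits of `bs`, and the induction puts the round for `b` in front of it.
  loops : ∀ bs {w st s n τ} → rounds ⊢ suspended w st (iterate s bs) ⟶[ n ] τ →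
          rounds ⊢ suspended (bs ʳ++ w) st s ⟶[ roundsCost s bs + n ] τ
  loops []       r = r
  loops (b ∷ bs) {s = s} {n} r with round b (iterate s bs)
  ... | within p q with r
  ... | within p′ r′ = weaken (≤-reflexive (rearrange (roundCost (iterate s bs)) (roundsCost s bs) n))
                         (loops bs (within (s≤s (+-mono-≤ p p′)) (loop refl q r′)))
    where
    rearrange : ∀ a b n → b + suc (2 + a + n) ≡ 3 + a + b + n
    rearrange = solve-∀

  iteration : Tree → Tree
  iteration x = iterate (i x) (encode (c x))

  -- The bits pass through both buffers in order to arrive on stack 0 in reversed order, above the
  -- blank that ends the loop. The initial state stays reversed on stack 1, as `suspended` requires.
  iterationCode : Cmd
  iterationCode = pairCode (code C) (code I) ⨟ TakeA.take ⨟ AB.transfer ⨟ TakeA.take ⨟ push 0F blank ⨟ BS.transfer ⨟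
                  rounds ⨟ pop 0F ⨟ AS.transfer

  iterationCost : Tree → ℕ
  iterationCost x = pairCost (cost C) (cost I) i x + (size (c x) * 13 + (11 * size (c x) + (size (i x) * 13 + (2 + (11 * size (c x) +
    (roundsCost (i x) (encode (c x)) + 1 + (1 + 11 * size (iteration x))))))))

  iterates : ∀ x {st} → iterationCode ⊢ main (encode x ▸ st) ⟶[ iterationCost x ] main (encode (iteration x) ▸ st)
  iterates x {st} =
    pairs C I x ⨟′ takeA (c x) ⨟′ flip ⨟′ takeA (i x) ⨟′ push₀ ⨟′ unload ⨟′
    loops (encode (c x)) {w = []} (exactly (exit refl)) ⨟′ pop₀ ⨟′ restoreA (iteration x)
    where
    flip : ∀ {s} → AB.transfer ⊢ s ∷ (rev (c x) ▸ []) ∷ [] ∷ [] ∷ [] ⟶[ 11 * size (c x) ]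
                                 s ∷ [] ∷ (encode (c x) ▸ []) ∷ [] ∷ []
    flip {s} = retarget (cong (λ bs → s ∷ [] ∷ (bs ▸ []) ∷ [] ∷ []) (rev-rev (c x)))
                        (within (restoreCost (c x)) (moveAB (rev (c x))))
    unload : ∀ {s a} → BS.transfer ⊢ s ∷ a ∷ (encode (c x) ▸ []) ∷ [] ∷ [] ⟶[ 11 * size (c x) ]
                                     (rev (c x) ▸ s) ∷ a ∷ [] ∷ [] ∷ []
    unload = within (subst (λ n → suc (n * 5) ≤ 11 * size (c x))
                           (trans (length-rev (c x)) (sym (length-encode (c x)))) (restoreCost (c x)))
                    (moveBS (encode (c x)))

  module _ {bound : Tree → ℕ} (bound-poly : Poly bound)
           (bounded : ∀ x → Throughout (λ s → size s ≤ bound x) (select f g) (i x) (encode (c x))) where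

    private
      roundBound : Tree → ℕ
      roundBound x = 3 + (2 + bound x) ^ proj₁ roundCost-poly

    roundsCost-bound : ∀ x → roundsCost (i x) (encode (c x)) ≤ length (encode (c x)) * roundBound x
    roundsCost-bound x = go (encode (c x)) (bounded x)
      where
      go : ∀ bs → Throughout (λ s → size s ≤ bound x) (select f g) (i x) bs →
           roundsCost (i x) bs ≤ length bs * roundBound x
      go []       _       = z≤n
      go (b ∷ bs) (_ , p) =
        +-mono-≤ (+-monoʳ-≤ 3 (≤-trans (proj₂ roundCost-poly (iterate (i x) bs))
                                       (^-monoˡ-≤ (proj₁ roundCost-poly) (+-monoʳ-≤ 2 (throughout-end bs p)))))
                 (go bs p)

    iterationᶜ : Computable iteration
    iterationᶜ = record
      { code     = iterationCode
      ; cost     = iterationCost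
      ; runs     = iterates
      ; costPoly = pairCost-poly C I ⊕ (h ⊗ const-poly 13 ⊕ (const-poly 11 ⊗ h ⊕ (sizePoly I ⊗ const-poly 13 ⊕
          (const-poly 2 ⊕ (const-poly 11 ⊗ h ⊕ (rounds-poly ⊕ const-poly 1 ⊕ (const-poly 1 ⊕ const-poly 11 ⊗ iteration-poly)))))))
      ; sizePoly = iteration-poly
      }
      where
      h : Poly (λ x → size (c x))
      h = sizePoly C
      iteration-poly : Poly (λ x → size (iteration x))
      iteration-poly = ≤-poly (λ x → throughout-end (encode (c x)) (bounded x)) bound-poly
      rounds-poly : Poly (λ x → roundsCost (i x) (encode (c x)))
      rounds-poly = ≤-poly roundsCost-bound
        (≤-poly (λ x → ≤-reflexive (length-encode (c x))) (const-poly 2 ⊗ h) ⊗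
         (const-poly 3 ⊕ power-poly (proj₁ roundCost-poly) bound-poly))

arg : ℕ → Tree → Tree
arg zero    x = hd x
arg (suc n) x = arg n (tl x)

argᶜ : ∀ n → Computable (arg n)
argᶜ zero    = hdᶜ
argᶜ (suc n) = argᶜ n ∘ᶜ tlᶜ

⟨_,_⟩ : Tree → Tree → Tree
⟨ t , u ⟩ = node (t ∷ u ∷ [])

⟨_,_⟩ᶜ : ∀ {f g} → Computable f → Computable g → Computable (λ x → ⟨ f x , g x ⟩)
⟨ F , G ⟩ᶜ = F ∷ᶜ G ∷ᶜ 𝟏ᶜ

size-⟨,⟩ : ∀ t u → size ⟨ t , u ⟩ ≡ 1 + (size t + size u)
size-⟨,⟩ t u = cong (λ n → 1 + (size t + n)) (+-identityʳ (size u))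

-- Paramorphisms over forests, with a parameter e: the function combine receives
-- e, the first tree and its value, the remaining forest and its value.

module Paramorphism (base combine : Tree → Tree) where

  para : Tree → List Tree → Tree
  para e []             = base e
  para e (node us ∷ ts) = combine (node (e ∷ node us ∷ para e us ∷ node ts ∷ para e ts ∷ []))

  paraᵀ : Tree → Tree
  paraᵀ x = para (arg 0 x) (subtrees (arg 1 x))

  -- The encoding of a tree is read backwards. A frame consists of a forest and
  -- its value; each closing bit starts an empty forest, and each opening bit
  -- puts the forest on top, as a single tree, into the forest below.

  frame : Tree → List Tree → Tree
  frame e ts = ⟨ node ts , para e ts ⟩

  merged : Tree → Tree → Tree → Tree
  merged e u v = ⟨ hd u ∷ᵀ hd v , combine (node (e ∷ arg 0 u ∷ arg 1 u ∷ arg 0 v ∷ arg 1 v ∷ [])) ⟩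

  opening closing : Tree → Tree
  opening s = if truth (tl (arg 1 s))
              then ⟨ arg 0 s , merged (arg 0 s) (arg 0 (arg 1 s)) (arg 1 (arg 1 s)) ∷ᵀ tl (tl (arg 1 s)) ⟩
              -- The opening bit of the root, read last, finds a single frame. The state is kept,
              -- because the value sought is that of the forest below the root.
              else s
  closing s = ⟨ arg 0 s , ⟨ 𝟏 , base (arg 0 s) ⟩ ∷ᵀ arg 1 s ⟩

  module _ (I : Computable base) (C : Computable combine) (para-poly : Poly (λ x → size (paraᵀ x))) where

    private
      mergedᶜ : ∀ {e u v} → Computable e → Computable u → Computable v →
                Computable (λ x → merged (e x) (u x) (v x))
      mergedᶜ E U V = ⟨ (hdᶜ ∘ᶜ U) ∷ᶜ (hdᶜ ∘ᶜ V) ,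
        C ∘ᶜ (E ∷ᶜ argᶜ 0 ∘ᶜ U ∷ᶜ argᶜ 1 ∘ᶜ U ∷ᶜ argᶜ 0 ∘ᶜ V ∷ᶜ argᶜ 1 ∘ᶜ V ∷ᶜ 𝟏ᶜ) ⟩ᶜ

      openingᶜ : Computable opening
      openingᶜ = ifᶜ tlᶜ ∘ᶜ argᶜ 1
        then ⟨ argᶜ 0 , mergedᶜ (argᶜ 0) (argᶜ 0 ∘ᶜ argᶜ 1) (argᶜ 1 ∘ᶜ argᶜ 1) ∷ᶜ (tlᶜ ∘ᶜ tlᶜ ∘ᶜ argᶜ 1) ⟩ᶜ
        else idᶜ

      closingᶜ : Computable closing
      closingᶜ = ⟨ argᶜ 0 , ⟨ 𝟏ᶜ , I ∘ᶜ argᶜ 0 ⟩ᶜ ∷ᶜ argᶜ 1 ⟩ᶜ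

      -- Here `m` and `n` are the sizes of the parameter and of the tree being read. The forests in
      -- the frames are parts of this tree, so `para-poly` applies to each of them, paired with the
      -- parameter; the pair has size at most `1 + (m + n)`. Each of the `2 * n` bits contributes at
      -- most the size of one frame.
      valueBound frameBound stateBound : ℕ → ℕ → ℕ
      valueBound m n = (3 + (m + n)) ^ proj₁ para-poly
      frameBound m n = 2 + (n + valueBound m n)
      stateBound m n = 2 + (m + 2 * n * frameBound m n)

      stateBound-poly : Poly (λ x → stateBound (size (arg 0 x)) (size (arg 1 x)))
      stateBound-poly = const-poly 2 ⊕ (sizePoly (argᶜ 0) ⊕ const-poly 2 ⊗ sizePoly (argᶜ 1) ⊗
        (const-poly 2 ⊕ (sizePoly (argᶜ 1) ⊕
          power-poly (proj₁ para-poly) (const-poly 1 ⊕ (sizePoly (argᶜ 0) ⊕ sizePoly (argᶜ 1))))))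

      state : Tree → List Tree → Tree
      state e fs = ⟨ e , node fs ⟩

      module Trace (e : Tree) (n : ℕ) where

        B : ℕ
        B = frameBound (size e) n

        frame-bound : ∀ ts → size* ts < n → size (frame e ts) ≤ B
        frame-bound ts p = begin
          size (frame e ts)                             ≡⟨ size-⟨,⟩ (node ts) (para e ts) ⟩
          2 + (size* ts + size (para e ts))             ≤⟨ +-monoʳ-≤ 2 (+-mono-≤ (<⇒≤ p) value) ⟩
          B                                             ∎
          where
          open ≤-Reasoning
          value : size (para e ts) ≤ valueBound (size e) n
          value = ≤-trans (proj₂ para-poly ⟨ e , node ts ⟩)
            (^-monoˡ-≤ (proj₁ para-poly) (+-monoʳ-≤ 3 (+-monoʳ-≤ (size e) (≤-trans (≤-reflexive (+-identityʳ _)) p))))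

        Bounded : Tree → Set
        Bounded s = size s ≤ stateBound (size e) n

        state-bound : ∀ fs {m} → size* fs ≤ m * B → m ≤ 2 * n → Bounded (state e fs)
        state-bound fs {m} p q = begin
          size (state e fs)             ≡⟨ size-⟨,⟩ e (node fs) ⟩
          1 + (size e + suc (size* fs)) ≡⟨ cong suc (+-suc (size e) (size* fs)) ⟩
          2 + (size e + size* fs)       ≤⟨ +-monoʳ-≤ 2 (+-monoʳ-≤ (size e) (≤-trans p (*-monoˡ-≤ B q))) ⟩
          stateBound (size e) n         ∎
          where open ≤-Reasoning

        record Good (w : List Bool) (fs : List Tree) : Set where
          constructor good
          field
            reached : foldr (select opening closing) (state e []) w ≡ state e fs
            small   : size* fs ≤ length w * B
            bounded : Throughout Bounded (select opening closing) (state e []) w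

        -- A closing bit adds one frame, and an opening bit replaces two frames by one. Hence the
        -- total size grows by at most `B` per bit, and the length of the encoding bounds it
        -- throughout.
        advance : ∀ b {w fs fs′} → suc (length w) ≤ 2 * n →
                  select opening closing b (state e fs) ≡ state e fs′ →
                  size* fs′ ≤ B + size* fs → Good w fs → Good (b ∷ w) fs′
        advance b {w} {fs} {fs′} l eq le (good r s t) =
          good r′ s′ (subst Bounded (sym r′) (state-bound fs′ {suc (length w)} s′ l) , t)
          where
          r′ = trans (cong (select opening closing b) r) eq
          s′ = ≤-trans le (+-monoʳ-≤ B s)

        suffix : ∀ (xs : List Bool) {w m} → length (xs ++ w) ≤ m → length w ≤ m
        suffix xs {w} p = ≤-trans (≤-trans (m≤n+m _ (length xs)) (≤-reflexive (sym (length-++ xs)))) p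

        close : ∀ {w fs} → suc (length w) ≤ 2 * n → 0 < n → Good w fs → Good (false ∷ w) (frame e [] ∷ fs)
        close {fs = fs} l p = advance false l refl (+-monoˡ-≤ (size* fs) (frame-bound [] p))

        mutual
          -- Reading goes backwards: `w` has been processed, and the top frame belongs to the trees
          -- following `t`. The closing bit of `t` starts a new frame, which has grown to that of
          -- `us` when the opening bit merges it.
          tree : ∀ t ts {w fs} → length (encode t ++ w) ≤ 2 * n → size* (t ∷ ts) < n →
                 Good w (frame e ts ∷ fs) → Good (encode t ++ w) (frame e (t ∷ ts) ∷ fs)
          tree (node us) ts {w} {fs} l p h rewrite ++-assoc (encode* us) [ false ] w =
            advance true l refl
              (≤-trans (+-monoˡ-≤ (size* fs) (frame-bound (node us ∷ ts) p))
                (+-monoʳ-≤ B (≤-trans (m≤n+m (size* fs) (size (frame e ts))) (m≤n+m _ (size (frame e us))))))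
              (forest us (≤-trans (n≤1+n _) l)
                (≤-trans (s≤s (≤-trans (m≤m+n (size* us) (size* ts)) (n≤1+n _))) p)
                (close (suffix (encode* us) (≤-trans (n≤1+n _) l)) (≤-trans (s≤s z≤n) p) h))

          forest : ∀ ts {w fs} → length (encode* ts ++ w) ≤ 2 * n → size* ts < n →
                   Good w (frame e [] ∷ fs) → Good (encode* ts ++ w) (frame e ts ∷ fs)
          forest []       l p h = h
          forest (t ∷ ts) {w} l p h rewrite ++-assoc (encode t) (encode* ts) w =
            tree t ts l p (forest ts (suffix (encode t) l) (≤-trans (s≤s (m≤n+m (size* ts) (size t))) p) h)

      traced : ∀ e t → Trace.Good e (size t) (encode t) (frame e (subtrees t) ∷ [])
      traced e (node us) =
        advance true l refl (m≤n+m _ B)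
          (forest us (≤-trans (n≤1+n _) l) ≤-refl
            (close (≤-trans (m≤m+n 1 _) (≤-reflexive (sym (+-suc (suc (size* us)) _)))) (s≤s z≤n)
              (good refl z≤n (state-bound [] {0} z≤n z≤n))))
        where
        open Trace e (size (node us))
        l : length (encode (node us)) ≤ 2 * size (node us)
        l = ≤-reflexive (length-encode (node us))

    paraᶜ : Computable paraᵀ
    paraᶜ = ≗-computable value (argᶜ 1 ∘ᶜ argᶜ 0 ∘ᶜ argᶜ 1 ∘ᶜ
        Iteration.iterationᶜ openingᶜ closingᶜ ⟨ argᶜ 0 , 𝟏ᶜ ⟩ᶜ (argᶜ 1) stateBound-poly
          (λ x → Trace.Good.bounded (traced (arg 0 x) (arg 1 x))))
      where
      value : ∀ x → _ ≡ paraᵀ x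
      value x = cong (λ s → arg 1 (arg 0 (arg 1 s))) (Trace.Good.reached (traced (arg 0 x) (arg 1 x)))

-- Boolean tests

Testable : (Tree → Bool) → Set
Testable p = Computable (λ x → fromBool (p x))

ifᵗ_then_else_ : ∀ {p g h} → Testable p → Computable g → Computable h → Computable (λ x → if p x then g x else h x)
ifᵗ_then_else_ {p} {g} {h} P G H =
  ≗-computable (λ x → cong (λ b → if b then g x else h x) (truth-fromBool (p x))) (ifᶜ P then G else H)

constᵗ : ∀ b → Testable (λ _ → b)
constᵗ false = 𝟏ᶜ
constᵗ true  = 𝟏ᶜ ∷ᶜ 𝟏ᶜ

truthᵗ : ∀ {f} → Computable f → Testable (λ x → truth (f x))
truthᵗ {f} F = ≗-computable (λ x → agrees (truth (f x))) (ifᶜ F then constᵗ true else constᵗ false)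
  where
  agrees : ∀ b → (if b then fromBool true else fromBool false) ≡ fromBool b
  agrees false = refl
  agrees true  = refl

notᵗ : ∀ {p} → Testable p → Testable (λ x → not (p x))
notᵗ {p} P = ≗-computable (λ x → agrees (p x)) (ifᵗ P then constᵗ false else constᵗ true)
  where
  agrees : ∀ b → (if b then fromBool false else fromBool true) ≡ fromBool (not b)
  agrees false = refl
  agrees true  = refl

infixr 6 _∧ᵗ_
infixr 5 _∨ᵗ_

_∧ᵗ_ : ∀ {p q} → Testable p → Testable q → Testable (λ x → p x ∧ q x)
_∧ᵗ_ {p} {q} P Q = ≗-computable (λ x → agrees (p x) (q x)) (ifᵗ P then Q else constᵗ false)
  where
  agrees : ∀ a b → (if a then fromBool b else fromBool false) ≡ fromBool (a ∧ b)
  agrees false b = refl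
  agrees true  b = refl

_∨ᵗ_ : ∀ {p q} → Testable p → Testable q → Testable (λ x → p x ∨ q x)
_∨ᵗ_ {p} {q} P Q = ≗-computable (λ x → agrees (p x) (q x)) (ifᵗ P then constᵗ true else Q)
  where
  agrees : ∀ a b → (if a then fromBool true else fromBool b) ≡ fromBool (a ∨ b)
  agrees false b = refl
  agrees true  b = refl

-- Canonical forms

insert : Tree → List Tree → List Tree
insert t []       = [ t ]
insert t (u ∷ us) = if t ≤ᵀ u then t ∷ u ∷ us else u ∷ insert t us

mutual
  canon : Tree → Tree
  canon (node ts) = node (canon* ts)

  canon* : List Tree → List Tree
  canon* []       = []
  canon* (t ∷ ts) = insert (canon t) (canon* ts)

-- Size equations of this kind supply the polynomial bound on values that `paraᶜ` demands.
size-insert : ∀ t us → size* (insert t us) ≡ size t + size* us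
size-insert t []       = refl
size-insert t (u ∷ us) with t ≤ᵀ u
... | true  = refl
... | false = begin
  size u + size* (insert t us)     ≡⟨ cong (size u +_) (size-insert t us) ⟩
  size u + (size t + size* us)     ≡⟨ rearrange (size u) (size t) (size* us) ⟩
  size t + (size u + size* us)     ∎
  where
  open ≡-Reasoning
  rearrange : ∀ a b c → a + (b + c) ≡ b + (a + c)
  rearrange = solve-∀

mutual
  size-canon : ∀ t → size (canon t) ≡ size t
  size-canon (node ts) = cong suc (size-canon* ts)

  size-canon* : ∀ ts → size* (canon* ts) ≡ size* ts
  size-canon* []       = refl
  size-canon* (t ∷ ts) =
    trans (size-insert (canon t) (canon* ts)) (cong₂ _+_ (size-canon t) (size-canon* ts))

forest : Tree → List Tree
forest x = subtrees (arg 1 x)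

suc-forest : ∀ x → suc (size* (forest x)) ≡ size (arg 1 x)
suc-forest x with arg 1 x
... | node _ = refl

module Insertion where

  base combine : Tree → Tree
  base e = e ∷ᵀ 𝟏
  combine x = if arg 0 x ≤ᵀ arg 1 x then arg 0 x ∷ᵀ arg 1 x ∷ᵀ arg 3 x else arg 1 x ∷ᵀ arg 4 x

  open Paramorphism base combine public

  correct : ∀ e ts → para e ts ≡ node (insert e ts)
  correct e []             = refl
  correct e (t@(node _) ∷ ts) with e ≤ᵀ t
  ... | true  = refl
  ... | false = cong (t ∷ᵀ_) (correct e ts)

  size-para : ∀ x → size (paraᵀ x) ≤ size (arg 0 x) + size (arg 1 x)
  size-para x = ≤-reflexive (begin
    size (paraᵀ x)                                   ≡⟨ cong size (correct (arg 0 x) (forest x)) ⟩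
    suc (size* (insert (arg 0 x) (forest x)))        ≡⟨ cong suc (size-insert (arg 0 x) (forest x)) ⟩
    suc (size (arg 0 x) + size* (forest x))          ≡⟨ +-suc (size (arg 0 x)) _ ⟨
    size (arg 0 x) + suc (size* (forest x))          ≡⟨ cong (size (arg 0 x) +_) (suc-forest x) ⟩
    size (arg 0 x) + size (arg 1 x)                  ∎)
    where open ≡-Reasoning

  computable : Computable paraᵀ
  computable = paraᶜ (idᶜ ∷ᶜ 𝟏ᶜ)
    (ifᵗ argᶜ 0 ≤ᶜ argᶜ 1 then argᶜ 0 ∷ᶜ argᶜ 1 ∷ᶜ argᶜ 3 else (argᶜ 1 ∷ᶜ argᶜ 4))
    (≤-poly size-para (sizePoly (argᶜ 0) ⊕ sizePoly (argᶜ 1)))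

insertᶜ : Computable (λ x → node (insert (arg 0 x) (forest x)))
insertᶜ = ≗-computable (λ x → Insertion.correct (arg 0 x) (forest x)) Insertion.computable

module Canonical where

  base combine : Tree → Tree
  base e = 𝟏
  combine x = node (insert (arg 2 x) (subtrees (arg 4 x)))

  open Paramorphism base combine public

  correct : ∀ e ts → para e ts ≡ node (canon* ts)
  correct e []             = refl
  correct e (node us ∷ ts) =
    -- The value of the forest `us` is `node (canon* us)`, which is already the canonical form of
    -- the first tree.
    cong₂ (λ r s → node (insert r (subtrees s))) (correct e us) (correct e ts)

  size-para : ∀ x → size (paraᵀ x) ≤ size (arg 1 x)
  size-para x = ≤-reflexive (begin
    size (paraᵀ x)                 ≡⟨ cong size (correct (arg 0 x) (forest x)) ⟩
    suc (size* (canon* (forest x))) ≡⟨ cong suc (size-canon* (forest x)) ⟩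
    suc (size* (forest x))         ≡⟨ suc-forest x ⟩
    size (arg 1 x)                 ∎)
    where open ≡-Reasoning

  computable : Computable paraᵀ
  computable = paraᶜ 𝟏ᶜ (insertᶜ ∘ᶜ ⟨ argᶜ 2 , argᶜ 4 ⟩ᶜ) (≤-poly size-para (sizePoly (argᶜ 1)))

canonᶜ : Computable canon
canonᶜ = ≗-computable correct (Canonical.computable ∘ᶜ ⟨ 𝟏ᶜ , idᶜ ⟩ᶜ)
  where
  correct : ∀ x → Canonical.paraᵀ ⟨ 𝟏 , x ⟩ ≡ canon x
  correct (node ts) = Canonical.correct 𝟏 ts

isomorphic : Tree → Tree → Bool
isomorphic t u = canon t ≤ᵀ canon u ∧ canon u ≤ᵀ canon t

isomorphicᵗ : ∀ {f g} → Computable f → Computable g → Testable (λ x → isomorphic (f x) (g x))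
isomorphicᵗ F G = (canonᶜ ∘ᶜ F ≤ᶜ canonᶜ ∘ᶜ G) ∧ᵗ (canonᶜ ∘ᶜ G ≤ᶜ canonᶜ ∘ᶜ F)

-- Forests up to isomorphism, as multisets

member : Tree → List Tree → Bool
member t []       = false
member t (u ∷ us) = isomorphic t u ∨ member t us

remove : Tree → List Tree → List Tree
remove t []       = []
remove t (u ∷ us) = if isomorphic t u then us else u ∷ remove t us

size-remove : ∀ t us → size* (remove t us) ≤ size* us
size-remove t []       = z≤n
size-remove t (u ∷ us) with isomorphic t u
... | true  = m≤n+m (size* us) (size u)
... | false = +-monoʳ-≤ (size u) (size-remove t us)

module Membership where

  base combine : Tree → Tree
  base e = 𝟏
  combine x = fromBool (isomorphic (arg 0 x) (arg 1 x) ∨ truth (arg 4 x))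

  open Paramorphism base combine public

  correct : ∀ e ts → para e ts ≡ fromBool (member e ts)
  correct e []             = refl
  correct e (t@(node _) ∷ ts) =
    cong (λ b → fromBool (isomorphic e t ∨ b)) (trans (cong truth (correct e ts)) (truth-fromBool (member e ts)))

  computable : Computable paraᵀ
  computable = paraᶜ 𝟏ᶜ (isomorphicᵗ (argᶜ 0) (argᶜ 1) ∨ᵗ truthᵗ (argᶜ 4))
    (≤-poly (λ x → ≤-trans (≤-reflexive (cong size (correct (arg 0 x) (forest x)))) (size-fromBool _)) (const-poly 2))

memberᵗ : Testable (λ x → member (arg 0 x) (forest x))
memberᵗ = ≗-computable (λ x → Membership.correct (arg 0 x) (forest x)) Membership.computable

module Removal where

  base combine : Tree → Tree
  base e = 𝟏
  combine x = if isomorphic (arg 0 x) (arg 1 x) then arg 3 x else arg 1 x ∷ᵀ arg 4 x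

  open Paramorphism base combine public

  correct : ∀ e ts → para e ts ≡ node (remove e ts)
  correct e []             = refl
  correct e (t@(node _) ∷ ts) with isomorphic e t
  ... | true  = refl
  ... | false = cong (t ∷ᵀ_) (correct e ts)

  size-para : ∀ x → size (paraᵀ x) ≤ size (arg 1 x)
  size-para x = begin
    size (paraᵀ x)                              ≡⟨ cong size (correct (arg 0 x) (forest x)) ⟩
    suc (size* (remove (arg 0 x) (forest x)))   ≤⟨ s≤s (size-remove (arg 0 x) (forest x)) ⟩
    suc (size* (forest x))                      ≡⟨ suc-forest x ⟩
    size (arg 1 x)                              ∎
    where open ≤-Reasoning

  computable : Computable paraᵀ
  computable = paraᶜ 𝟏ᶜ (ifᵗ isomorphicᵗ (argᶜ 0) (argᶜ 1) then argᶜ 3 else (argᶜ 1 ∷ᶜ argᶜ 4))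
    (≤-poly size-para (sizePoly (argᶜ 1)))

removeᶜ : Computable (λ x → node (remove (arg 0 x) (forest x)))
removeᶜ = ≗-computable (λ x → Removal.correct (arg 0 x) (forest x)) Removal.computable

-- Greedy division and the search for a divisor

finished : List Tree × Bool → Bool
finished (rest , ok) = null rest ∧ ok

-- The result consists of the trees of `bs` still without a partner and of the verdict on the
-- unmatched trees. The recursive call on `us` starts again from all of `bs`, so both calls are
-- values of one paramorphism with parameter `bs`.
greedy : List Tree → List Tree → List Tree × Bool
greedy bs []             = bs , true
greedy bs (node us ∷ ts) with greedy bs ts
... | rest , ok = if member (node us) rest then (remove (node us) rest , ok)
                  else (rest , ok ∧ finished (greedy bs us))

divides : Tree → Tree → Bool
divides B A = finished (greedy (subtrees B) (subtrees A))

module Division where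

  done : Tree → Bool
  done s = not (truth (arg 0 s)) ∧ truth (arg 1 s)

  base combine : Tree → Tree
  base e = ⟨ e , fromBool true ⟩
  combine x = if member (arg 1 x) (subtrees (arg 0 (arg 4 x)))
              then ⟨ node (remove (arg 1 x) (subtrees (arg 0 (arg 4 x)))) , arg 1 (arg 4 x) ⟩
              else ⟨ arg 0 (arg 4 x) , fromBool (truth (arg 1 (arg 4 x)) ∧ done (arg 2 x)) ⟩

  open Paramorphism base combine public

  encoded : List Tree × Bool → Tree
  encoded (rest , ok) = ⟨ node rest , fromBool ok ⟩

  done-encoded : ∀ s → done (encoded s) ≡ finished s
  done-encoded ([]    , ok) = truth-fromBool ok
  done-encoded (_ ∷ _ , ok) = refl

  correct : ∀ bs ts → para (node bs) ts ≡ encoded (greedy bs ts)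
  correct bs []                = refl
  correct bs (t@(node us) ∷ ts) rewrite correct bs ts | correct bs us | done-encoded (greedy bs us) with greedy bs ts
  ... | rest , ok with member t rest
  ... | true  = refl
  ... | false rewrite truth-fromBool ok = refl

  size-greedy : ∀ bs ts → size* (proj₁ (greedy bs ts)) ≤ size* bs
  size-greedy bs []             = ≤-refl
  size-greedy bs (node us ∷ ts) with greedy bs ts | size-greedy bs ts
  ... | rest , ok | p with member (node us) rest
  ... | true  = ≤-trans (size-remove (node us) rest) p
  ... | false = p

  correct′ : ∀ e ts → para e ts ≡ encoded (greedy (subtrees e) ts)
  correct′ (node bs) = correct bs

  size-para : ∀ x → size (paraᵀ x) ≤ 3 + size (arg 0 x)
  size-para x with arg 0 x
  ... | e@(node bs) = begin
    size (para e (forest x))                                        ≡⟨ cong size (correct bs (forest x)) ⟩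
    size (encoded (greedy bs (forest x)))                           ≡⟨ size-⟨,⟩ (node (proj₁ (greedy bs (forest x)))) _ ⟩
    2 + (size* (proj₁ (greedy bs (forest x))) + size (fromBool (proj₂ (greedy bs (forest x)))))
      ≤⟨ +-monoʳ-≤ 2 (+-mono-≤ (size-greedy bs (forest x)) (size-fromBool _)) ⟩
    2 + (size* bs + 2)                                              ≡⟨ cong (2 +_) (+-comm (size* bs) 2) ⟩
    3 + size e                                                      ∎
    where open ≤-Reasoning

  doneᵗ : ∀ {f} → Computable f → Testable (λ x → done (f x))
  doneᵗ F = notᵗ (truthᵗ (argᶜ 0 ∘ᶜ F)) ∧ᵗ truthᵗ (argᶜ 1 ∘ᶜ F)

  computable : Computable paraᵀ
  computable = paraᶜ ⟨ idᶜ , constᵗ true ⟩ᶜ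
    (ifᵗ memberᵗ ∘ᶜ ⟨ argᶜ 1 , argᶜ 0 ∘ᶜ argᶜ 4 ⟩ᶜ
     then ⟨ removeᶜ ∘ᶜ ⟨ argᶜ 1 , argᶜ 0 ∘ᶜ argᶜ 4 ⟩ᶜ , argᶜ 1 ∘ᶜ argᶜ 4 ⟩ᶜ
     else ⟨ argᶜ 0 ∘ᶜ argᶜ 4 , truthᵗ (argᶜ 1 ∘ᶜ argᶜ 4) ∧ᵗ doneᵗ (argᶜ 2) ⟩ᶜ)
    (≤-poly size-para (const-poly 3 ⊕ sizePoly (argᶜ 0)))

dividesᵗ : ∀ {f g} → Computable f → Computable g → Testable (λ x → divides (f x) (g x))
dividesᵗ {f} {g} F G = ≗-computable correct (Division.doneᵗ (Division.computable ∘ᶜ ⟨ F , G ⟩ᶜ))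
  where
  correct : ∀ x → fromBool (Division.done (Division.para (f x) (subtrees (g x)))) ≡ fromBool (divides (f x) (g x))
  correct x = cong fromBool (trans (cong Division.done (Division.correct′ (f x) (subtrees (g x))))
                                   (Division.done-encoded (greedy (subtrees (f x)) (subtrees (g x)))))

-- The condition `truth t` excludes `𝟏`, which divides every tree.
search : Tree → List Tree → Bool
search T []                = false
search T (t@(node us) ∷ ts) = (search T us ∨ search T ts) ∨ (truth t ∧ divides t T)

module Search where

  base combine : Tree → Tree
  base e = 𝟏
  combine x = fromBool ((truth (arg 2 x) ∨ truth (arg 4 x)) ∨ (truth (arg 1 x) ∧ divides (arg 1 x) (arg 0 x)))

  open Paramorphism base combine public

  correct : ∀ T ts → para T ts ≡ fromBool (search T ts)
  correct T []                = refl
  correct T (t@(node us) ∷ ts)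
    rewrite correct T us | correct T ts | truth-fromBool (search T us) | truth-fromBool (search T ts) = refl

  computable : Computable paraᵀ
  computable = paraᶜ 𝟏ᶜ ((truthᵗ (argᶜ 2) ∨ᵗ truthᵗ (argᶜ 4)) ∨ᵗ (truthᵗ (argᶜ 1) ∧ᵗ dividesᵗ (argᶜ 1) (argᶜ 0)))
    (≤-poly (λ x → ≤-trans (≤-reflexive (cong size (correct (arg 0 x) (forest x)))) (size-fromBool _)) (const-poly 2))

composite : Tree → Bool
composite T = search T (subtrees T)

abstract
  compositeᵗ : Testable composite
  compositeᵗ = ≗-computable (λ x → Search.correct x (subtrees x)) (Search.computable ∘ᶜ ⟨ idᶜ , idᶜ ⟩ᶜ)

-- Isomorphism as an equivalence relation

open Homogeneous using (Permutation; prep; swap)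
pattern pointwise eqs = Homogeneous.refl eqs
pattern _then_ p q = Homogeneous.trans p q

mutual
  ≅-refl : ∀ {t} → t ≅ t
  ≅-refl {node ts} = match (pointwise (≅-refl* ts))

  ≅-refl* : ∀ ts → Pointwise _≅_ ts ts
  ≅-refl* []       = []
  ≅-refl* (t ∷ ts) = ≅-refl ∷ ≅-refl* ts

mutual
  ≅-sym : ∀ {t u} → t ≅ u → u ≅ t
  ≅-sym (match p) = match (↭-symmetric p)

  ↭-symmetric : ∀ {ts us} → Permutation _≅_ ts us → Permutation _≅_ us ts
  ↭-symmetric (pointwise eqs) = pointwise (≅-sym* eqs)
  ↭-symmetric (prep e p)      = prep (≅-sym e) (↭-symmetric p)
  ↭-symmetric (swap e f p)    = swap (≅-sym f) (≅-sym e) (↭-symmetric p)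
  ↭-symmetric (p then q)      = ↭-symmetric q then ↭-symmetric p

  ≅-sym* : ∀ {ts us} → Pointwise _≅_ ts us → Pointwise _≅_ us ts
  ≅-sym* []         = []
  ≅-sym* (e ∷ eqs) = ≅-sym e ∷ ≅-sym* eqs

≅-trans : ∀ {t u v} → t ≅ u → u ≅ v → t ≅ v
≅-trans (match p) (match q) = match (p then q)

≅-setoid : Setoid 0ℓ 0ℓ
≅-setoid = record { Carrier = Tree ; _≈_ = _≅_ ; isEquivalence = record { refl = ≅-refl ; sym = ≅-sym ; trans = ≅-trans } }

open import Data.List.Relation.Binary.Permutation.Setoid ≅-setoid
  using (_↭_; ↭-refl; ↭-sym; ↭-trans; ↭-prep; module PermutationReasoning)
open import Data.List.Relation.Binary.Permutation.Setoid.Properties ≅-setoid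
  using (All-resp-↭; Any-resp-↭; ++⁺; ++⁺ˡ; ++-comm; shifts; ↭-shift; dropMiddle)

mutual
  size-≅ : ∀ {t u} → t ≅ u → size t ≡ size u
  size-≅ (match p) = cong suc (size-↭ p)

  size-↭ : ∀ {ts us} → ts ↭ us → size* ts ≡ size* us
  size-↭ (pointwise eqs) = size-≅* eqs
  size-↭ (prep e p)      = cong₂ _+_ (size-≅ e) (size-↭ p)
  size-↭ {t ∷ u ∷ ts} {u′ ∷ t′ ∷ us} (swap e f p) = begin
    size t + (size u + size* ts)     ≡⟨ cong₂ _+_ (size-≅ e) (cong₂ _+_ (size-≅ f) (size-↭ p)) ⟩
    size t′ + (size u′ + size* us)   ≡⟨ rearrange (size t′) (size u′) (size* us) ⟩
    size u′ + (size t′ + size* us)   ∎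
    where
    open ≡-Reasoning
    rearrange : ∀ a b c → a + (b + c) ≡ b + (a + c)
    rearrange = solve-∀
  size-↭ (p then q)      = trans (size-↭ p) (size-↭ q)

  size-≅* : ∀ {ts us} → Pointwise _≅_ ts us → size* ts ≡ size* us
  size-≅* []        = refl
  size-≅* (e ∷ eqs) = cong₂ _+_ (size-≅ e) (size-≅* eqs)

-- The order on trees

leq-refl : ∀ xs → leq xs xs ≡ true
leq-refl []           = refl
leq-refl (false ∷ xs) = leq-refl xs
leq-refl (true ∷ xs)  = leq-refl xs

leq-total : ∀ xs ys → leq xs ys ≡ false → leq ys xs ≡ true
leq-total (x ∷ xs)     []           _ = refl
leq-total (true ∷ xs)  (false ∷ ys) _ = refl
leq-total (false ∷ xs) (false ∷ ys) p = leq-total xs ys p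
leq-total (true ∷ xs)  (true ∷ ys)  p = leq-total xs ys p

leq-antisym : ∀ xs ys → leq xs ys ≡ true → leq ys xs ≡ true → xs ≡ ys
leq-antisym []           []           _ _ = refl
leq-antisym (false ∷ xs) (false ∷ ys) p q = cong (false ∷_) (leq-antisym xs ys p q)
leq-antisym (true ∷ xs)  (true ∷ ys)  p q = cong (true ∷_) (leq-antisym xs ys p q)

leq-trans : ∀ xs ys zs → leq xs ys ≡ true → leq ys zs ≡ true → leq xs zs ≡ true
leq-trans []           ys           zs           p q = refl
leq-trans (false ∷ xs) (false ∷ ys) (false ∷ zs) p q = leq-trans xs ys zs p q
leq-trans (false ∷ xs) (_ ∷ ys)     (true ∷ zs)  p q = refl
leq-trans (true ∷ xs)  (true ∷ ys)  (true ∷ zs)  p q = leq-trans xs ys zs p q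

mutual
  -- The remainders `v` and `w` make the induction work: encodings are prefix-free, and the closing
  -- bit marks where a forest ends.
  encode-injective : ∀ t u {v w} → encode t ++ v ≡ encode u ++ w → t ≡ u × v ≡ w
  encode-injective (node ts) (node us) {v} {w} eq
    rewrite ++-assoc (encode* ts) [ false ] v | ++-assoc (encode* us) [ false ] w
    with encode*-injective ts us (proj₂ (∷-injective eq))
  ... | refl , v≡w = refl , v≡w

  encode*-injective : ∀ ts us {v w} → encode* ts ++ false ∷ v ≡ encode* us ++ false ∷ w → ts ≡ us × v ≡ w
  encode*-injective []             []             refl = refl , refl
  encode*-injective []             (node _ ∷ _)   ()
  encode*-injective (node _ ∷ _)   []             ()
  encode*-injective (t ∷ ts)       (u ∷ us) {v} {w} eq
    rewrite ++-assoc (encode t) (encode* ts) (false ∷ v) | ++-assoc (encode u) (encode* us) (false ∷ w)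
    with encode-injective t u eq
  ... | refl , eq′ with encode*-injective ts us eq′
  ... | refl , v≡w = refl , v≡w

≤ᵀ-antisym : ∀ t u → t ≤ᵀ u ≡ true → u ≤ᵀ t ≡ true → t ≡ u
≤ᵀ-antisym t u p q = proj₁ (encode-injective t u {[]} {[]} (cong (_++ []) (begin
  encode t             ≡⟨ rev-rev t ⟨
  rev t ʳ++ []    ≡⟨ cong (_ʳ++ []) (leq-antisym (rev t) (rev u) p q) ⟩
  rev u ʳ++ []    ≡⟨ rev-rev u ⟩
  encode u             ∎)))
  where open ≡-Reasoning

-- This makes `canon*` invariant under transpositions. When `v` separates `t` from `u`, transitivity
-- fixes their order; when both precede `v`, totality and antisymmetry settle it, since trees that
-- precede each other are equal.
insert-comm : ∀ t u vs → insert t (insert u vs) ≡ insert u (insert t vs)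
insert-comm t u [] with t ≤ᵀ u in p | u ≤ᵀ t in q
... | true  | true  rewrite ≤ᵀ-antisym t u p q = refl
... | true  | false = refl
... | false | true  = refl
... | false | false = contradiction (trans (sym (leq-total (rev t) (rev u) p)) q) λ ()
insert-comm t u (v ∷ vs) with t ≤ᵀ v in p | u ≤ᵀ v in q
... | false | false rewrite p | q = cong (v ∷_) (insert-comm t u vs)
... | true  | false with u ≤ᵀ t in r
...   | true  = contradiction (trans (sym (leq-trans (rev u) (rev t) (rev v) r p)) q) λ ()
...   | false rewrite p | q = refl
insert-comm t u (v ∷ vs) | false | true with t ≤ᵀ u in r
...   | true  = contradiction (trans (sym (leq-trans (rev t) (rev u) (rev v) r q)) p) λ ()
...   | false rewrite p | q = refl
insert-comm t u (v ∷ vs) | true | true with t ≤ᵀ u in r | u ≤ᵀ t in s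
... | true  | true  rewrite ≤ᵀ-antisym t u r s = refl
... | true  | false rewrite q = refl
... | false | true  rewrite p = refl
... | false | false = contradiction (trans (sym (leq-total (rev t) (rev u) r)) s) λ ()

mutual
  canon-≅ : ∀ {t u} → t ≅ u → canon t ≡ canon u
  canon-≅ (match p) = cong node (canon-↭ p)

  canon-↭ : ∀ {ts us} → ts ↭ us → canon* ts ≡ canon* us
  canon-↭ (pointwise eqs) = canon-≅* eqs
  canon-↭ (prep e p)      = cong₂ insert (canon-≅ e) (canon-↭ p)
  canon-↭ {t ∷ u ∷ ts} {u′ ∷ t′ ∷ us} (swap e f p) = begin
    insert (canon t) (insert (canon u) (canon* ts))     ≡⟨ cong₂ insert (canon-≅ e) (cong₂ insert (canon-≅ f) (canon-↭ p)) ⟩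
    insert (canon t′) (insert (canon u′) (canon* us))   ≡⟨ insert-comm (canon t′) (canon u′) (canon* us) ⟩
    insert (canon u′) (insert (canon t′) (canon* us))   ∎
    where open ≡-Reasoning
  canon-↭ (p then q)      = trans (canon-↭ p) (canon-↭ q)

  canon-≅* : ∀ {ts us} → Pointwise _≅_ ts us → canon* ts ≡ canon* us
  canon-≅* []        = refl
  canon-≅* (e ∷ eqs) = cong₂ insert (canon-≅ e) (canon-≅* eqs)

insert-↭ : ∀ t us → insert t us ↭ t ∷ us
insert-↭ t []       = ↭-refl
insert-↭ t (u ∷ us) with t ≤ᵀ u
... | true  = ↭-refl
... | false = ↭-prep u (insert-↭ t us) then swap ≅-refl ≅-refl ↭-refl

mutual
  ≅-canon : ∀ t → canon t ≅ t
  ≅-canon (node ts) = match (↭-canon* ts)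

  ↭-canon* : ∀ ts → canon* ts ↭ ts
  ↭-canon* []       = ↭-refl
  ↭-canon* (t ∷ ts) = insert-↭ (canon t) (canon* ts) then prep (≅-canon t) (↭-canon* ts)

-- Comparison in both directions means equality of canonical forms by antisymmetry. These are
-- invariant under isomorphism (`canon-≅`) and isomorphic to the original trees (`≅-canon`).
isomorphic-reflects : ∀ t u → Reflects (t ≅ u) (isomorphic t u)
isomorphic-reflects t u with canon t ≤ᵀ canon u in p | canon u ≤ᵀ canon t in q
... | true  | true  = ofʸ (≅-trans (≅-sym (≅-canon t)) (subst (_≅ u) (sym (≤ᵀ-antisym (canon t) (canon u) p q)) (≅-canon u)))
... | true  | false = ofⁿ λ e → contradiction (trans (sym (leq-refl (rev (canon u)))) (trans (cong (canon u ≤ᵀ_) (sym (canon-≅ e))) q)) λ ()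
... | false | _     = ofⁿ λ e → contradiction (trans (sym (leq-refl (rev (canon t)))) (trans (cong (canon t ≤ᵀ_) (canon-≅ e)) p)) λ ()

member-reflects : ∀ t us → Reflects (Any (t ≅_) us) (member t us)
member-reflects t []       = ofⁿ λ ()
member-reflects t (u ∷ us) with isomorphic t u | isomorphic-reflects t u
... | true  | ofʸ e  = ofʸ (here e)
... | false | ofⁿ ¬e with member t us | member-reflects t us
...   | true  | ofʸ m  = ofʸ (there m)
...   | false | ofⁿ ¬m = ofⁿ λ { (here e) → ¬e e ; (there m) → ¬m m }

remove-↭ : ∀ t us → Any (t ≅_) us → us ↭ t ∷ remove t us
remove-↭ t (u ∷ us) m with isomorphic t u | isomorphic-reflects t u | m
... | true  | ofʸ e  | _       = prep (≅-sym e) ↭-refl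
... | false | ofⁿ ¬e | here e  = contradiction e ¬e
... | false | ofⁿ ¬e | there m = ↭-prep u (remove-↭ t us m) then swap ≅-refl ≅-refl ↭-refl

-- Division

Divides : Tree → Tree → Set
Divides B T = ∃[ A ] T ≅ A · B

Divides-resp : ∀ {B t u} → t ≅ u → Divides B t → Divides B u
Divides-resp e (A , f) = A , ≅-trans (≅-sym e) f

All-Divides-·* : ∀ as B → All (Divides B) (as ·* B)
All-Divides-·* []       B = []
All-Divides-·* (a ∷ as) B = (a , ≅-refl) ∷ All-Divides-·* as B

quotients : ∀ {B ts} → All (Divides B) ts → ∃[ as ] ts ↭ as ·* B
quotients []             = [] , ↭-refl
quotients ((a , e) ∷ ds) with quotients ds
... | as , p = a ∷ as , prep e p

Any-≅-resp : ∀ {us t u} → t ≅ u → Any (t ≅_) us → Any (u ≅_) us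
Any-≅-resp e (here f)  = here (≅-trans (≅-sym e) f)
Any-≅-resp e (there m) = there (Any-≅-resp e m)

module _ (B : Tree) where

  -- The invariant of `greedy`. By `disjoint`, the matched trees form the multiset intersection of
  -- `ts` and `subtrees B`, up to isomorphism.
  record Matching (ts : List Tree) (result : List Tree × Bool) : Set where
    field
      unmatched matched : List Tree
      split-ts  : ts ↭ matched ++ unmatched
      split-bs  : subtrees B ↭ matched ++ proj₁ result
      disjoint  : All (λ t → ¬ Any (t ≅_) (proj₁ result)) unmatched
      verdict   : Reflects (All (Divides B) unmatched) (proj₂ result)

  open Matching

  -- Cancelling the matched trees from `ts ↭ as ·* B ++ subtrees B` leaves
  -- `unmatched m ↭ as ·* B ++ rest`. A tree in `rest` would thus have an isomorphic copy among the
  -- unmatched ones, against `disjoint`. So `rest` is empty, and the unmatched trees are exactly the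
  -- multiples in `as ·* B`.
  exact : ∀ {ts result} (m : Matching ts result) → Divides B (node ts) →
          proj₁ result ≡ [] × All (Divides B) (unmatched m)
  exact {ts} {rest , ok} m (node as , match p) = empty rest (++⁻ʳ (as ·* B) (disjoint′ unmatched-↭)) , divisible
    where
    open PermutationReasoning
    unmatched-↭ : unmatched m ↭ as ·* B ++ rest
    unmatched-↭ = dropMiddle [] [] (begin
      matched m ++ unmatched m          ↭⟨ split-ts m ⟨
      ts                                ↭⟨ p ⟩
      as ·* B ++ subtrees B             ↭⟨ ++⁺ˡ (as ·* B) (split-bs m) ⟩
      as ·* B ++ matched m ++ rest      ↭⟨ shifts (as ·* B) (matched m) ⟩
      matched m ++ as ·* B ++ rest      ∎)
    disjoint′ : ∀ {us} → unmatched m ↭ us → All (λ t → ¬ Any (t ≅_) rest) us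
    disjoint′ q = All-resp-↭ (λ e ¬any any → ¬any (Any-≅-resp (≅-sym e) any)) q (disjoint m)
    empty : ∀ us → All (λ t → ¬ Any (t ≅_) us) us → us ≡ []
    empty []       _          = refl
    empty (u ∷ us) (¬any ∷ _) = contradiction (here ≅-refl) ¬any
    divisible : All (Divides B) (unmatched m)
    divisible with empty rest (++⁻ʳ (as ·* B) (disjoint′ unmatched-↭))
    ... | refl = All-resp-↭ Divides-resp (↭-sym unmatched-↭)
                   (subst (All (Divides B)) (sym (++-identityʳ (as ·* B))) (All-Divides-·* as B))

  Matching-finished : ∀ {ts} result → Matching ts result → Reflects (Divides B (node ts)) (finished result)
  Matching-finished (_ ∷ _ , _) m = ofⁿ λ d → contradiction (proj₁ (exact m d)) λ ()
  Matching-finished ([] , false) m with verdict m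
  ... | ofⁿ ¬ds = ofⁿ λ d → ¬ds (proj₂ (exact m d))
  Matching-finished {ts} ([] , true) m with verdict m
  ... | ofʸ ds with quotients ds
  ... | as , p = ofʸ (node as , match (begin
    ts                            ↭⟨ split-ts m ⟩
    matched m ++ unmatched m      ↭⟨ ++-comm (matched m) (unmatched m) ⟩
    unmatched m ++ matched m      ↭⟨ ++⁺ p (↭-sym (subst (subtrees B ↭_) (++-identityʳ (matched m)) (split-bs m))) ⟩
    as ·* B ++ subtrees B         ∎))
    where open PermutationReasoning

  -- If `t` finds a partner, `rest` only shrinks and `disjoint` persists. Otherwise `t` joins the
  -- unmatched trees, and the matching of its own subtrees decides whether `B` divides it.
  matching : ∀ ts → Matching ts (greedy (subtrees B) ts)
  matching [] = record
    { unmatched = [] ; matched = [] ; split-ts = ↭-refl ; split-bs = ↭-refl ; disjoint = [] ; verdict = ofʸ [] }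
  matching (t@(node us) ∷ ts) with greedy (subtrees B) ts | matching ts
  ... | rest , ok | m with member t rest | member-reflects t rest
  ...   | true  | ofʸ t∈rest = record
    { unmatched = unmatched m
    ; matched   = t ∷ matched m
    ; split-ts  = ↭-prep t (split-ts m)
    ; split-bs  = ↭-trans (split-bs m) (↭-trans (++⁺ˡ (matched m) removed) (↭-shift (matched m) (remove t rest)))
    ; disjoint  = All.map (λ ¬any any → ¬any (Any-resp-↭ ≅-respʳ (↭-sym removed) (there any))) (disjoint m)
    ; verdict   = verdict m
    }
    where
    removed : rest ↭ t ∷ remove t rest
    removed = remove-↭ t rest t∈rest
    ≅-respʳ : ∀ {u v w} → v ≅ w → u ≅ v → u ≅ w
    ≅-respʳ e f = ≅-trans f e
  ...   | false | ofⁿ t∉rest = record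
    { unmatched = t ∷ unmatched m
    ; matched   = matched m
    ; split-ts  = ↭-trans (↭-prep t (split-ts m)) (↭-sym (↭-shift (matched m) (unmatched m)))
    ; split-bs  = split-bs m
    ; disjoint  = t∉rest ∷ disjoint m
    ; verdict   = both (verdict m) (Matching-finished (greedy (subtrees B) us) (matching us))
    }
    where
    both : ∀ {a b} → Reflects (All (Divides B) (unmatched m)) a → Reflects (Divides B t) b →
           Reflects (All (Divides B) (t ∷ unmatched m)) (a ∧ b)
    both (ofʸ ds) (ofʸ d)  = ofʸ (d ∷ ds)
    both (ofʸ ds) (ofⁿ ¬d) = ofⁿ λ { (d ∷ _) → ¬d d }
    both (ofⁿ ¬ds) _       = ofⁿ λ { (_ ∷ ds) → ¬ds ds }

divides-reflects : ∀ B T → Reflects (Divides B T) (divides B T)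
divides-reflects B (node ts) = Matching-finished B _ (matching B ts)

-- Proper descendants

infix 4 _⊏_

data _⊏_ (t : Tree) : List Tree → Set where
  child  : ∀ {ts} → t ⊏ t ∷ ts
  inside : ∀ {us ts} → t ⊏ us → t ⊏ node us ∷ ts
  later  : ∀ {u ts} → t ⊏ ts → t ⊏ u ∷ ts

⊏-size : ∀ {t ts} → t ⊏ ts → size t ≤ size* ts
⊏-size {t} {_ ∷ ts} child        = m≤m+n (size t) (size* ts)
⊏-size {ts = _ ∷ ts} (inside p)  = ≤-trans (⊏-size p) (≤-trans (n≤1+n _) (m≤m+n _ (size* ts)))
⊏-size {ts = u ∷ _} (later p)    = ≤-trans (⊏-size p) (m≤n+m _ (size u))

mutual
  ⊏-resp-↭ : ∀ {t ts us} → ts ↭ us → t ⊏ ts → ∃[ u ] u ⊏ us × t ≅ u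
  ⊏-resp-↭ (pointwise eqs)   p                  = ⊏-resp-≅* eqs p
  ⊏-resp-↭ (prep e q)        child              = _ , child , e
  ⊏-resp-↭ (prep e q)        (inside p)         = inside′ e p
  ⊏-resp-↭ (prep e q)        (later p) with ⊏-resp-↭ q p
  ... | _ , r , f = _ , later r , f
  ⊏-resp-↭ (swap e f q)      child              = _ , later child , e
  ⊏-resp-↭ (swap e f q)      (later child)      = _ , child , f
  ⊏-resp-↭ (swap e f q)      (later (inside p)) = inside′ f p
  ⊏-resp-↭ (swap e f q)      (inside p) with inside′ e p
  ... | _ , r , g = _ , later r , g
  ⊏-resp-↭ (swap e f q)      (later (later p)) with ⊏-resp-↭ q p
  ... | _ , r , g = _ , later (later r) , g
  ⊏-resp-↭ (q then r)        p with ⊏-resp-↭ q p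
  ... | _ , p′ , e with ⊏-resp-↭ r p′
  ...   | _ , p″ , f = _ , p″ , ≅-trans e f

  ⊏-resp-≅* : ∀ {t ts us} → Pointwise _≅_ ts us → t ⊏ ts → ∃[ u ] u ⊏ us × t ≅ u
  ⊏-resp-≅* (e ∷ eqs) child      = _ , child , e
  ⊏-resp-≅* (e ∷ eqs) (inside p) = inside′ e p
  ⊏-resp-≅* (e ∷ eqs) (later p) with ⊏-resp-≅* eqs p
  ... | _ , r , f = _ , later r , f

  inside′ : ∀ {t ts u us} → node ts ≅ u → t ⊏ ts → ∃[ v ] v ⊏ u ∷ us × t ≅ v
  inside′ (match q) p with ⊏-resp-↭ q p
  ... | _ , r , e = _ , inside r , e

-- The search visits descendants of `T` itself, whereas the factor `B` is found inside `A · B`; this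
-- carries it over, up to isomorphism.
⊏-resp-≅ : ∀ {t u v} → u ≅ v → t ⊏ subtrees u → ∃[ w ] w ⊏ subtrees v × t ≅ w
⊏-resp-≅ (match p) = ⊏-resp-↭ p

-- The factor B is a proper descendant in A · B unless A = 𝟏, because the
-- subtree at a leaf of A is B itself.

⊏-· : ∀ a {ts} B → B ⊏ a · B ∷ ts
⊏-· (node [])       (node bs) = child
⊏-· (node (a ∷ as)) B         = inside (⊏-· a B)

mutual
  ·-congʳ : ∀ A {B C} → B ≅ C → A · B ≅ A · C
  ·-congʳ (node as) (match p) = match (++⁺ (pointwise (·*-congʳ as (match p))) p)

  ·*-congʳ : ∀ as {B C} → B ≅ C → Pointwise _≅_ (as ·* B) (as ·* C)
  ·*-congʳ []       e = []
  ·*-congʳ (a ∷ as) e = ·-congʳ a e ∷ ·*-congʳ as e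

-- Correctness of the primality test

Divisor : Tree → List Tree → Set
Divisor T ts = ∃[ t ] t ⊏ ts × truth t ≡ true × Divides t T

search-reflects : ∀ T ts → Reflects (Divisor T ts) (search T ts)
search-reflects T [] = ofⁿ λ { (_ , () , _) }
search-reflects T (t@(node us) ∷ ts) with search T us | search-reflects T us
... | true  | ofʸ (u , p , q) = ofʸ (u , inside p , q)
... | false | ofⁿ ¬us with search T ts | search-reflects T ts
...   | true  | ofʸ (u , p , q) = ofʸ (u , later p , q)
...   | false | ofⁿ ¬ts with truth t in eq | divides t T | divides-reflects t T
...     | true  | true  | ofʸ d  = ofʸ (t , child , eq , d)
...     | true  | false | ofⁿ ¬d = ofⁿ λ
  { (_ , child , _ , d)    → ¬d d
  ; (u , inside p , q)     → ¬us (u , p , q)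
  ; (u , later p , q)      → ¬ts (u , p , q) }
...     | false | _     | _      = ofⁿ λ
  { (_ , child , q , _)    → contradiction (trans (sym q) eq) λ ()
  ; (u , inside p , q)     → ¬us (u , p , q)
  ; (u , later p , q)      → ¬ts (u , p , q) }

·-identityʳ : ∀ A → A · 𝟏 ≡ A
·-identityʳ (node as) = cong node (trans (++-identityʳ (as ·* 𝟏)) (·*-identityʳ as))
  where
  ·*-identityʳ : ∀ as → as ·* 𝟏 ≡ as
  ·*-identityʳ []       = refl
  ·*-identityʳ (a ∷ as) = cong₂ _∷_ (·-identityʳ a) (·*-identityʳ as)

truth-≅ : ∀ {t u} → t ≅ u → truth t ≡ true → truth u ≡ true
truth-≅ {u = node (_ ∷ _)} _ _ = refl
truth-≅ {node (node _ ∷ _)} {node []} e _ with size-≅ e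
... | ()

-- A divisor found by the search is smaller than `T` and not a leaf, so it cannot be a factor of a
-- trivial factorization. Conversely, if both `A` and `B` have children, then `B` lies properly
-- inside `A · B`; its isomorphic copy `u` in `T` divides `T` as well and would have been found.
mult-prime-reflects : ∀ T → 1 < size T → Reflects (MultPrime T) (not (composite T))
mult-prime-reflects T 1<T with composite T | search-reflects T (subtrees T)
... | true | ofʸ (t , t⊏T , t≢𝟏 , A , T≅A·t) = ofⁿ λ (_ , prime) → refute (prime A t T≅A·t)
  where
  smaller : ∀ T → t ⊏ subtrees T → size t < size T
  smaller (node ts) p = s≤s (⊏-size p)
  refute : ¬ ((A ≅ 𝟏 × t ≅ T) ⊎ (A ≅ T × t ≅ 𝟏))
  refute (inj₁ (_ , t≅T)) = <⇒≢ (smaller T t⊏T) (size-≅ t≅T)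
  refute (inj₂ (_ , t≅𝟏)) = contradiction (truth-≅ t≅𝟏 t≢𝟏) λ ()
... | false | ofⁿ ¬divisor = ofʸ (1<T , prime)
  where
  prime : ∀ A B → T ≅ A · B → (A ≅ 𝟏 × B ≅ T) ⊎ (A ≅ T × B ≅ 𝟏)
  prime (node []) (node bs) e = inj₁ (≅-refl , ≅-sym e)
  prime A (node [])         e = inj₂ (subst (_≅ T) (·-identityʳ A) (≅-sym e) , ≅-refl)
  prime A@(node (a ∷ _)) B@(node (_ ∷ _)) e with ⊏-resp-≅ (≅-sym e) (⊏-· a B)
  ... | u , u⊏T , B≅u =
    contradiction (u , u⊏T , truth-≅ B≅u refl , A , ≅-trans e (·-congʳ A B≅u)) ¬divisor

-- Explicit time polynomials and the deciding machine

times2+ : ℕ → Polynomial → Polynomial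
times2+ c []      = [ c ]
times2+ c (a ∷ p) = (c + 2 * a) ∷ times2+ a p

powerOf2+ : ℕ → Polynomial
powerOf2+ zero    = [ 1 ]
powerOf2+ (suc k) = times2+ 0 (powerOf2+ k)

-- In multiplying by `2 + n`, the number `c` is the coefficient carried over from the next lower
-- place; it is 0 at the start.
eval-times2+ : ∀ c p n → eval (times2+ c p) n ≡ c + (2 + n) * eval p n
eval-times2+ c []      n = cong (c +_) (trans (*-zeroʳ n) (sym (*-zeroʳ (2 + n))))
eval-times2+ c (a ∷ p) n rewrite eval-times2+ a p n = rearrange c a n (eval p n)
  where
  rearrange : ∀ c a n e → c + 2 * a + n * (a + (2 + n) * e) ≡ c + (2 + n) * (a + n * e)
  rearrange = solve-∀

eval-powerOf2+ : ∀ k n → eval (powerOf2+ k) n ≡ (2 + n) ^ k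
eval-powerOf2+ zero    n = cong suc (*-zeroʳ n)
eval-powerOf2+ (suc k) n = trans (eval-times2+ 0 (powerOf2+ k) n) (cong ((2 + n) *_) (eval-powerOf2+ k n))

module _ {p : Tree → Bool} (P : Testable p) where

  -- Removing the opening bit exposes the second bit of `fromBool (p x)`, which equals the verdict.
  decider : Cmd
  decider = code P ⨟ pop 0F

  -- The inner 1 is the final pop, the outer `suc` the step that delivers the verdict.
  deciderTime-poly : Poly (λ x → suc (cost P x + 1))
  deciderTime-poly = const-poly 1 ⊕ (costPoly P ⊕ const-poly 1)

  decider-runs : ∀ T → ∃[ σ ] decider ⊢ main (List.map bit (encode T)) ⟶[ cost P T + 1 ] σ × isTrue 0F (tops σ) ≡ p T
  decider-runs T =
    rest (p T) , started ⨟′ popped (p T) , verdict (p T)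
    where
    started : code P ⊢ main (List.map bit (encode T)) ⟶[ cost P T ] main (encode (fromBool (p T)) ▸ [])
    started = subst (λ s → code P ⊢ main s ⟶[ cost P T ] main (encode (fromBool (p T)) ▸ []))
                    (sym (▸-[] (encode T))) (runs P T)
    rest : Bool → Store
    rest b = main (List.drop 1 (encode (fromBool b)) ▸ [])
    popped : ∀ b → pop 0F ⊢ main (encode (fromBool b) ▸ []) ⟶[ 1 ] rest b
    popped false = pop₀
    popped true  = pop₀
    verdict : ∀ b → isTrue 0F (tops (rest b)) ≡ b
    verdict false = refl
    verdict true  = refl

  testable-decidable : ∃[ M ] ∃[ q ] ∀ T {Q : Set} → Reflects Q (p T) → DecidesWithin M (eval q (size T)) (encode T) Q
  testable-decidable = M , q , λ T reflects → p T , verdict T , reflects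
    where
    M = machine decider (isTrue 0F)
    q = powerOf2+ (proj₁ deciderTime-poly)
    verdict : ∀ T → run M (eval q (size T)) (initial M (encode T)) ≡ just (p T)
    verdict T with decider-runs T
    ... | σ , within {n} n≤ r , eq = begin
      run M (eval q (size T)) (initial M (encode T))  ≡⟨ cong (λ t → run M t (initial M (encode T))) time ⟩
      run M (n + suc spare) (initial M (encode T))    ≡⟨ machine-decides spare r ⟩
      just (isTrue 0F (tops σ))                       ≡⟨ cong just eq ⟩
      just (p T)                                      ∎
      where
      open ≡-Reasoning
      limit = (2 + size T) ^ proj₁ deciderTime-poly
      enough : suc n ≤ limit
      enough = ≤-trans (s≤s n≤) (proj₂ deciderTime-poly T)
      spare = limit ∸ suc n
      time : eval q (size T) ≡ n + suc spare
      time = trans (eval-powerOf2+ (proj₁ deciderTime-poly) (size T))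
                   (trans (sym (m+[n∸m]≡n enough)) (sym (+-suc n spare)))

proposition12 : ∃[ M ] ∃[ p ] ∀ (T : Tree) → 1 < size T →
    DecidesWithin M (eval p (size T)) (encode T) (MultPrime T)
proposition12 = proj₁ decision , proj₁ (proj₂ decision) ,
    λ T 1<T → proj₂ (proj₂ decision) T (mult-prime-reflects T 1<T)
  where
  decision = testable-decidable (notᵗ compositeᵗ)
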